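{- There is a Turing machine $M_{\mathrm{heap}}$ that, given a number $k$ and a closed term $s$, halts in time $O(p(|s|,k))$ for some polynomial $p$ and in space $O(|s|\cdot q(k))$ for some polynomial $q$. If $s$ has a normal form $t$ and $k\ge 4\cdot\mathrm{Time}(s)+2$, it computes a heap $H$ and a closure $g$ such that $g\gg_H t$. Otherwise, it halts in a distinguished final state denoting failure.
   Context: $\mathsf{L}$-terms (de Bruijn): $s::=n\mid st\mid\lambda s$, size $|n|=1+n$, $|\lambda s|=1+|s|$, $|st|=1+|s|+|t|$; closed means no free de Bruijn indices. Substitution $k^k_u=u$, $n^k_u=n$ ($n\ne k$), $(st)^k_u=(s^k_u)(t^k_u)$, $(\lambda s)^k_u=\lambda(s^{k+1}_u)$. Reduction: $(\lambda s)(\lambda t)\succ s^0_{\lambda t}$; $s\succ s'\Rightarrow st\succ s't$; $t\succ t'\Rightarrow(\lambda s)t\succ(\lambda s)t'$. If $s\succ^j t$ with $t$ an abstraction (the normal form), $\mathrm{Time}(s)=j$. Programs are lists of commands $\mathsf{ret},\mathsf{var}\,n,\mathsf{lam},\mathsf{app}$; $\gamma n=[\mathsf{var}\,n]$, $\gamma(st)=\gamma s++\gamma t++[\mathsf{app}]$, $\gamma(\lambda s)=\mathsf{lam}::\gamma s++[\mathsf{ret}]$; terms are stored on tape as $\gamma s$ with unary indices. $P\gg s$ iff $P=\gamma u$ and $s=\lambda u$. A closure is a pair $(P,a)$ of a program and an address $a\in\mathbb N$; a heap entry is a pair $(g,b)$ of a closure and an address; a heap $H$ is a list of entries; $H[a]$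 is the $a$-th entry for $1\le a\le|H|$, undefined otherwise. Lookup: if $H[a]=(g,b)$ then $H[a,0]=g$ and $H[a,n+1]=H[b,n]$; else undefined. Unfolding $\langle s,a\rangle\triangleright^H_k s'$ is inductively defined: $\langle n,a\rangle\triangleright^H_k n$ if $n<k$; $\langle n,a\rangle\triangleright^H_k s'$ if $n\ge k$, $H[a,n-k]=(P,b)$, $P\gg u$, $\langle u,b\rangle\triangleright^H_0 s'$; $\langle\lambda s,a\rangle\triangleright^H_k\lambda s'$ if $\langle s,a\rangle\triangleright^H_{k+1}s'$; $\langle st,a\rangle\triangleright^H_k s't'$ if $\langle s,a\rangle\triangleright^H_k s'$ and $\langle t,a\rangle\triangleright^H_k t'$. $(P,a)\gg_H s$ iff $P\gg u$ and $\langle u,a\rangle\triangleright^H_0 s$ for some $u$. -}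

module Defs where

open import Data.Bool using (Bool; true; false; if_then_else_)
open import Data.Fin using (Fin)
open import Data.Fin.Patterns using (2F; 3F)
open import Data.List using (List; []; _∷_; _++_; map; concatMap; replicate; length)
open import Data.List.Relation.Unary.All using (All)
open import Data.Maybe using (Maybe; just; nothing; _>>=_)
open import Data.Nat using (ℕ; zero; suc; _+_; _*_; _∸_; _≤_; _<_; _≟_)
open import Data.Nat.GeneralisedArithmetic using (iterate)
open import Data.Nat.Solver using (module +-*-Solver)
open import Data.Product using (∃-syntax; _×_; _,_)
open import Data.Sum using (_⊎_; inj₁)
open import Data.Vec using (Vec; []; _∷_; lookup; zipWith) renaming (map to mapᵛ; sum to sumᵛ; replicate to replicateᵛ)
open import Function using (_∘_; _↔_)
open import Relation.Binary.PropositionalEquality using (_≡_)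
open import Relation.Nullary using (does)

------------------------------------------------------------------------
-- The weak call-by-value λ-calculus L

infixl 7 _·_
infix  6 ƛ_
infix  4 _≻_ _≻^[_]_

data Term : Set where
  `_  : ℕ → Term
  _·_ : Term → Term → Term
  ƛ_  : Term → Term

∣_∣ᵗ : Term → ℕ
∣ ` n ∣ᵗ   = 1 + n
∣ s · t ∣ᵗ = 1 + ∣ s ∣ᵗ + ∣ t ∣ᵗ
∣ ƛ s ∣ᵗ   = 1 + ∣ s ∣ᵗ

-- All free indices of the term are below k.
data Bound (k : ℕ) : Term → Set where
  `_  : ∀ {n} → n < k → Bound k (` n)
  _·_ : ∀ {s t} → Bound k s → Bound k t → Bound k (s · t)
  ƛ_  : ∀ {s} → Bound (suc k) s → Bound k (ƛ s)

Closed : Term → Set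
Closed = Bound 0

-- Not capture-avoiding: u is not shifted under binders, which is harmless
-- only because reduction is applied to closed terms.
subst : Term → ℕ → Term → Term
subst (` n)   k u = if does (n ≟ k) then u else ` n
subst (s · t) k u = subst s k u · subst t k u
subst (ƛ s)   k u = ƛ subst s (suc k) u

data _≻_ : Term → Term → Set where
  β  : ∀ {s t} → (ƛ s) · (ƛ t) ≻ subst s 0 (ƛ t)
  ξₗ : ∀ {s s′ t} → s ≻ s′ → s · t ≻ s′ · t
  ξᵣ : ∀ {s t t′} → t ≻ t′ → (ƛ s) · t ≻ (ƛ s) · t′

data _≻^[_]_ : Term → ℕ → Term → Set where
  done : ∀ {s} → s ≻^[ 0 ] s
  step : ∀ {s s′ t j} → s ≻ s′ → s′ ≻^[ j ] t → s ≻^[ suc j ] t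

Abstraction : Term → Set
Abstraction t = ∃[ u ] t ≡ ƛ u

-- t is the normal form of s, and Time(s) = j.
NormalForm : Term → Term → ℕ → Set
NormalForm s t j = s ≻^[ j ] t × Abstraction t

------------------------------------------------------------------------
-- Programs, closures and heaps

data Command : Set where
  ret : Command
  var : ℕ → Command
  lam : Command
  app : Command

Program : Set
Program = List Command

γ : Term → Program
γ (` n)   = var n ∷ []
γ (s · t) = γ s ++ γ t ++ app ∷ []
γ (ƛ s)   = lam ∷ γ s ++ ret ∷ []

infix 4 _≫_

_≫_ : Program → Term → Set
P ≫ s = ∃[ u ] P ≡ γ u × s ≡ ƛ u

Address : Set
Address = ℕ

Closure : Set
Closure = Program × Address

Entry : Set
Entry = Closure × Address

Heap : Set
Heap = List Entry

-- Addresses count from 1: H [ 0 ] is undefined.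
_[_] : Heap → Address → Maybe Entry
[]      [ _ ]           = nothing
(_ ∷ _) [ zero ]        = nothing
(e ∷ _) [ suc zero ]    = just e
(_ ∷ H) [ suc (suc a) ] = H [ suc a ]

_[_∙_] : Heap → Address → ℕ → Maybe Closure
H [ a ∙ zero ]  = H [ a ] >>= λ (g , _) → just g
H [ a ∙ suc n ] = H [ a ] >>= λ (_ , b) → H [ b ∙ n ]

infix 4 ⟨_,_⟩▷[_,_]_ _≫[_]_

-- ⟨ s , a ⟩▷[ H , k ] s′ is the unfolding of s to s′ at depth k.
data ⟨_,_⟩▷[_,_]_ : Term → Address → Heap → ℕ → Term → Set where
  bound : ∀ {n a H k} → n < k → ⟨ ` n , a ⟩▷[ H , k ] ` n
  free  : ∀ {n a H k P b u s′} → k ≤ n → H [ a ∙ n ∸ k ] ≡ just (P , b) →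
          P ≫ u → ⟨ u , b ⟩▷[ H , 0 ] s′ → ⟨ ` n , a ⟩▷[ H , k ] s′
  ƛ_    : ∀ {s a H k s′} → ⟨ s , a ⟩▷[ H , suc k ] s′ → ⟨ ƛ s , a ⟩▷[ H , k ] ƛ s′
  _·_   : ∀ {s t a H k s′ t′} → ⟨ s , a ⟩▷[ H , k ] s′ → ⟨ t , a ⟩▷[ H , k ] t′ →
          ⟨ s · t , a ⟩▷[ H , k ] s′ · t′

_≫[_]_ : Closure → Heap → Term → Set
(P , a) ≫[ H ] s = ∃[ u ] P ≫ u × ⟨ u , a ⟩▷[ H , 0 ] s

------------------------------------------------------------------------
-- Deterministic multi-tape Turing machines

Finite : Set → Set
Finite A = ∃[ n ] (A ↔ Fin n)

data Move : Set where
  left stay right : Move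

-- A tape is infinite in both directions; every cell outside the listed
-- ones is blank.  The cells to the left are listed nearest first.
record Tape (C : Set) : Set where
  constructor _◂_▸_
  field
    lefts  : List C
    head   : C
    rights : List C

-- A Turing machine with n tapes, whose inputs and outputs are words over A.
-- Besides the symbols of A, it may use its own finite set of work symbols;
-- `nothing` is the blank.
record TM (A : Set) (n : ℕ) : Set₁ where
  field
    Work         : Set
    Work-finite  : Finite Work
    State        : Set
    State-finite : Finite State

  Cell : Set
  Cell = Maybe (A ⊎ Work)

  field
    start : State
    final : State → Bool
    δ     : State → Vec Cell n → State × Vec (Cell × Move) n

module _ {A : Set} {n : ℕ} (M : TM A n) where
  open TM M

  Config : Set
  Config = State × Vec (Tape Cell) n

  act : Cell × Move → Tape Cell → Tape Cell
  act (c , stay)  (ls       ◂ _ ▸ rs)       = ls ◂ c ▸ rs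
  act (c , left)  ([]       ◂ _ ▸ rs)       = [] ◂ nothing ▸ (c ∷ rs)
  act (c , left)  ((l ∷ ls) ◂ _ ▸ rs)       = ls ◂ l ▸ (c ∷ rs)
  act (c , right) (ls       ◂ _ ▸ [])       = (c ∷ ls) ◂ nothing ▸ []
  act (c , right) (ls       ◂ _ ▸ (r ∷ rs)) = (c ∷ ls) ◂ r ▸ rs

  -- A configuration in a final state is repeated forever.
  next : Config → Config
  next (q , ts) with final q
  ... | true  = q , ts
  ... | false = let q′ , as = δ q (mapᵛ Tape.head ts) in q′ , zipWith act as ts

  run : ℕ → Config → Config
  run i c = iterate next c i

  Halted : Config → Set
  Halted (q , _) = final q ≡ true

  HaltsWithin : ℕ → Config → Set
  HaltsWithin b c = ∃[ i ] i ≤ b × Halted (run i c)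

  HaltsWith : (Config → Set) → Config → Set
  HaltsWith Q c = ∃[ i ] Halted (run i c) × Q (run i c)

  -- As listed cells are never dropped, this counts the input cells together
  -- with all cells visited so far.
  tapeSize : Tape Cell → ℕ
  tapeSize (ls ◂ _ ▸ rs) = length ls + 1 + length rs

  size : Config → ℕ
  size (_ , ts) = sumᵛ (mapᵛ tapeSize ts)

  SpaceWithin : ℕ → Config → Set
  SpaceWithin b c = ∀ i → size (run i c) ≤ b

  word : List A → List Cell
  word = map (just ∘ inj₁)

  blankTape : Tape Cell
  blankTape = [] ◂ nothing ▸ []

  writeTape : List A → Tape Cell
  writeTape []      = blankTape
  writeTape (x ∷ w) = [] ◂ just (inj₁ x) ▸ word w

  -- The tape holds w and nothing else, with the head on its first symbol.
  Holds : List A → Tape Cell → Set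
  Holds w (ls ◂ c ▸ rs) =
    All (_≡ nothing) ls × ∃[ m ] c ∷ rs ≡ word w ++ replicate m nothing

------------------------------------------------------------------------
-- Encoding on tapes

data Symbol : Set where
  RET VAR LAM APP : Symbol
  I               : Symbol   -- digit of unary numbers
  #               : Symbol   -- end marker

unary : ℕ → List Symbol
unary n = replicate n I

encCommand : Command → List Symbol
encCommand ret     = RET ∷ []
encCommand (var n) = VAR ∷ unary n
encCommand lam     = LAM ∷ []
encCommand app     = APP ∷ []

encProgram : Program → List Symbol
encProgram = concatMap encCommand

encTerm : Term → List Symbol
encTerm s = encProgram (γ s)

encClosure : Closure → List Symbol
encClosure (P , a) = encProgram P ++ # ∷ unary a ++ # ∷ []

encEntry : Entry → List Symbol
encEntry (g , b) = encClosure g ++ unary b ++ # ∷ []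

encHeap : Heap → List Symbol
encHeap = concatMap encEntry

-- Tapes 0 and 1 carry the inputs k and s, tapes 2 and 3 the outputs H and g.
module _ {w : ℕ} (M : TM Symbol (4 + w)) where

  input : ℕ → Term → Config M
  input k s = TM.start M ,
    writeTape M (unary k) ∷ writeTape M (encTerm s) ∷ replicateᵛ (2 + w) (blankTape M)

  Outputs : Heap → Closure → Config M → Set
  Outputs H g (_ , ts) =
    Holds M (encHeap H) (lookup ts 2F) × Holds M (encClosure g) (lookup ts 3F)

------------------------------------------------------------------------
-- Resource bounds

-- Polynomials in m variables with coefficients in ℕ, as expressions.  On ℕ
-- the solver interprets its formal negation as the identity.
open +-*-Solver public using (Polynomial) renaming (⟦_⟧ to evalPoly)

eval₁ : Polynomial 1 → ℕ → ℕ
eval₁ q x = evalPoly q (x ∷ [])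

eval₂ : Polynomial 2 → ℕ → ℕ → ℕ
eval₂ p x y = evalPoly p (x ∷ y ∷ [])

-- The constants c are those of the O-notation; the bounds hold for all inputs.
module _ {w : ℕ} (M : TM Symbol (4 + w)) where

  HaltsInTimeO : (ℕ → ℕ → ℕ) → Set
  HaltsInTimeO f = ∃[ c ] ∀ k s → Closed s → HaltsWithin M (c * f ∣ s ∣ᵗ k) (input M k s)

  RunsInSpaceO : (ℕ → ℕ → ℕ) → Set
  RunsInSpaceO f = ∃[ c ] ∀ k s → Closed s → SpaceWithin M (c * f ∣ s ∣ᵗ k) (input M k s)

{-# OPTIONS --safe #-}

-- A tape whose head is on its first nonblank cell is a stack, so programs over
-- finitely many stacks compile to Turing machines with constant overhead.  One
-- such program interprets γ s on the heap machine, which evaluates a term to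
-- normal form in exactly 4 Time(s) + 2 steps: each β-step is an app, and the
-- lengths of the task and value lists determine how many of the other steps
-- have been made.  Each step therefore costs one unit of the fuel k.
--
-- All programs on the tapes are subprograms of γ s, and an environment chain has
-- at most k entries, so one step takes time linear in |s| and polynomial in k.
-- The total time is thus bounded by |s| · q(k), and with it the space.
module Submission where

open import Defs
open import Data.Bool using (Bool; true; false; if_then_else_; not; _∧_)
open import Data.Bool.Properties using (∧-zeroʳ)
open import Data.Empty using (⊥)
open import Data.Fin using (Fin; zero; suc)
open import Data.Fin.Patterns
open import Data.Fin.Properties using (+↔⊎)
open import Data.List using (List; []; _∷_; _++_; _ʳ++_; head; drop; length)
open import Data.List.Properties using (++-assoc; ++-identityʳ; ++-ʳ++; ʳ++-ʳ++; length-ʳ++; length-replicate; length-++; length-map; concatMap-++)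
open import Data.List.Relation.Unary.All using (All; []; _∷_)
import Data.List.Relation.Unary.All as All
open import Data.List.Relation.Unary.All.Properties using (replicate⁺; ++⁺; ++⁻ˡ; ++⁻ʳ)
open import Data.Maybe using (Maybe; just; nothing; maybe; fromMaybe) renaming (map to mapᴹ)
open import Data.Nat using (ℕ; zero; suc; _+_; _*_; _∸_; _≤_; _<_; _≥_; z≤n; s≤s; _≟_)
open import Data.Nat.Properties
open import Data.Nat.Solver using (module +-*-Solver)
open import Data.Product using (Σ-syntax; ∃-syntax; _×_; _,_; proj₁; proj₂; map₁)
open import Data.Sum using (_⊎_; inj₁; inj₂)
open import Data.Sum.Function.Propositional using (_⊎-↔_)
open import Data.Unit using (⊤; tt)
open import Data.Vec using (Vec; []; _∷_; lookup; updateAt; zipWith; _[_]≔_) renaming (map to mapᵛ; sum to sumᵛ; replicate to replicateᵛ)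
open import Data.Vec.Properties using (lookup-map; lookup∘updateAt; lookup∘updateAt′; updateAt-updateAt; updateAt-commutes; updateAt-id-local; updateAt-cong; updateAt-cong-local)
open import Function using (_∘_; _↔_; mk↔ₛ′; const)
open import Function.Construct.Composition using (_↔-∘_)
open import Function.Construct.Symmetry using (↔-sym)
open import Relation.Nullary using (¬_; yes; no; contradiction)
open import Relation.Nullary.Decidable using (dec-true; dec-false)
open import Relation.Binary.PropositionalEquality using (_≡_; _≢_; refl; sym; trans; cong; cong₂; module ≡-Reasoning)

-- The heap machine keeps no trace of the term under evaluation, so correctness rests on reading a
-- state back: the values are unfolded through the heap and the pending tasks are executed
-- symbolically on them, with `app` building an application instead of contracting it
-- (`Represents`). Every step but `app` leaves the term read back unchanged; `app` contracts its
-- next redex. The constants in 4 Time(s) + 2 come from the difference between the numbers of tasks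
-- and values, which starts at 1 and ends at -1: a silent step lowers it by 1, an `app` raises it by
-- 3, so each β-step accounts for itself and three silent steps. Represented states are never stuck,
-- so a run that stops with tasks left has spent all its fuel, and failure requires no analysis of
-- divergence. The obstacle for space is that the factor |s| may enter only once. Time is therefore
-- counted in units `U`, linear in |s|, that cover the longest word moved by one loop, and the
-- number of units must be bounded in k alone. In particular a de Bruijn index is bounded by the
-- length of the heap, not by |s|.

-- Stack programs and their compilation to Turing machines

module StackMachine where

  open import Data.Vec.Relation.Binary.Pointwise.Inductive using (Pointwise; []; _∷_)

  private variable
    n t u : ℕ

  ⊎-finite : {A B : Set} → Finite A → Finite B → Finite (A ⊎ B)
  ⊎-finite (m , f) (n , g) = m + n , (↔-sym +↔⊎ ↔-∘ (f ⊎-↔ g))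

  ⊤-finite : Finite ⊤
  ⊤-finite = 1 , mk↔ₛ′ (λ _ → zero) (λ _ → tt) (λ { zero → refl }) (λ _ → refl)

  ⊥-finite : Finite ⊥
  ⊥-finite = 0 , mk↔ₛ′ (λ ()) (λ ()) (λ ()) (λ ())

  Bool-finite : Finite Bool
  Bool-finite = 2 , mk↔ₛ′ (λ { false → zero ; true → suc zero }) (λ { zero → false ; (suc _) → true })
    (λ { zero → refl ; (suc zero) → refl }) (λ { false → refl ; true → refl })

  Maybe-finite : {A : Set} → Finite A → Finite (Maybe A)
  Maybe-finite {A} A-finite = let n , f = ⊎-finite ⊤-finite A-finite in n , (f ↔-∘ maybe↔⊎)
    where
    maybe↔⊎ : Maybe A ↔ (⊤ ⊎ A)
    maybe↔⊎ = mk↔ₛ′ (λ { nothing → inj₁ tt ; (just x) → inj₂ x }) (λ { (inj₁ _) → nothing ; (inj₂ x) → just x })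
      (λ { (inj₁ _) → refl ; (inj₂ _) → refl }) (λ { nothing → refl ; (just _) → refl })

  Symbol-finite : Finite Symbol
  Symbol-finite = 6 , mk↔ₛ′ to from
    (λ { zero → refl ; (suc zero) → refl ; (suc (suc zero)) → refl ; (suc (suc (suc zero))) → refl
       ; (suc (suc (suc (suc zero)))) → refl ; (suc (suc (suc (suc (suc zero))))) → refl })
    (λ { RET → refl ; VAR → refl ; LAM → refl ; APP → refl ; I → refl ; # → refl })
    where
    to : Symbol → Fin 6
    to RET = zero
    to VAR = suc zero
    to LAM = suc (suc zero)
    to APP = suc (suc (suc zero))
    to I   = suc (suc (suc (suc zero)))
    to #   = suc (suc (suc (suc (suc zero))))

    from : Fin 6 → Symbol
    from zero                                = RET
    from (suc zero)                          = VAR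
    from (suc (suc zero))                    = LAM
    from (suc (suc (suc zero)))              = APP
    from (suc (suc (suc (suc zero))))        = I
    from (suc (suc (suc (suc (suc zero))))) = #

  Stacks : ℕ → Set
  Stacks n = Vec (List Symbol) n

  Tops : ℕ → Set
  Tops n = Vec (Maybe Symbol) n

  tops : Stacks n → Tops n
  tops = mapᵛ head

  infixr 5 _⨟_
  infix  4 _⊢_⇓[_]_

  data Prog (n : ℕ) : Set where
    pop    : Fin n → Prog n
    push   : Fin n → (Tops n → Symbol) → Prog n
    _⨟_    : Prog n → Prog n → Prog n
    branch : (Tops n → Bool) → Prog n → Prog n → Prog n
    while  : (Tops n → Bool) → Prog n → Prog n

  private variable
    p q : Prog n
    b : Tops n → Bool
    σ σ′ σ″ : Stacks n

  -- t is an upper bound on the number of Turing machine steps.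
  data _⊢_⇓[_]_ {n} : Prog n → Stacks n → ℕ → Stacks n → Set where
    pop    : ∀ {i σ} → pop i ⊢ σ ⇓[ 1 ] updateAt σ i (drop 1)
    push   : ∀ {i f σ} → push i f ⊢ σ ⇓[ 2 ] updateAt σ i (f (tops σ) ∷_)
    _⨟_    : p ⊢ σ ⇓[ t ] σ′ → q ⊢ σ′ ⇓[ u ] σ″ → p ⨟ q ⊢ σ ⇓[ t + u ] σ″
    thenᵇ  : b (tops σ) ≡ true → p ⊢ σ ⇓[ t ] σ′ → branch b p q ⊢ σ ⇓[ 1 + t ] σ′
    elseᵇ  : b (tops σ) ≡ false → q ⊢ σ ⇓[ t ] σ′ → branch b p q ⊢ σ ⇓[ 1 + t ] σ′
    again  : b (tops σ) ≡ true → p ⊢ σ ⇓[ t ] σ′ → while b p ⊢ σ′ ⇓[ u ] σ″ →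
             while b p ⊢ σ ⇓[ 1 + t + u ] σ″
    leave  : b (tops σ) ≡ false → while b p ⊢ σ ⇓[ 1 ] σ
    weaken : t ≤ u → p ⊢ σ ⇓[ t ] σ′ → p ⊢ σ ⇓[ u ] σ′

  Cell : Set
  Cell = Maybe (Symbol ⊎ ⊥)

  symbol : Cell → Maybe Symbol
  symbol (just (inj₁ c)) = just c
  symbol nothing         = nothing

  -- For `branch` and `while`, `nothing` is the point at which the test is made.
  Point : Prog n → Set
  Point (pop i)        = ⊤
  Point (push i f)     = Maybe Symbol
  Point (p ⨟ q)        = Point p ⊎ Point q
  Point (branch b p q) = Maybe (Point p ⊎ Point q)
  Point (while b p)    = Maybe (Point p)

  Point-finite : (p : Prog n) → Finite (Point p)
  Point-finite (pop i)        = ⊤-finite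
  Point-finite (push i f)     = Maybe-finite Symbol-finite
  Point-finite (p ⨟ q)        = ⊎-finite (Point-finite p) (Point-finite q)
  Point-finite (branch b p q) = Maybe-finite (⊎-finite (Point-finite p) (Point-finite q))
  Point-finite (while b p)    = Maybe-finite (Point-finite p)

  entry : (p : Prog n) → Point p
  entry (pop i)        = tt
  entry (push i f)     = nothing
  entry (p ⨟ q)        = inj₁ (entry p)
  entry (branch b p q) = nothing
  entry (while b p)    = nothing

  Actions : ℕ → Set
  Actions n = Vec (Cell × Move) n

  idle : Vec Cell n → Actions n
  idle = mapᵛ (_, stay)

  at : Fin n → Cell × Move → Vec Cell n → Actions n
  at i a cs = idle cs [ i ]≔ a

  -- The point nothing is the exit.  A push remembers the symbol while the head
  -- moves to the free cell.
  control : (p : Prog n) → Point p → Vec Cell n → Maybe (Point p) × Actions n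
  control (pop i) _ cs = nothing , at i (nothing , right) cs
  control (push i f) nothing  cs = just (just (f (mapᵛ symbol cs))) , at i (lookup cs i , left) cs
  control (push i f) (just c) cs = nothing , at i (just (inj₁ c) , stay) cs
  control (p ⨟ q) (inj₁ x) cs = map₁ (just ∘ maybe inj₁ (inj₂ (entry q))) (control p x cs)
  control (p ⨟ q) (inj₂ y) cs = map₁ (mapᴹ inj₂) (control q y cs)
  control (branch b p q) nothing cs =
    just (just (if b (mapᵛ symbol cs) then inj₁ (entry p) else inj₂ (entry q))) , idle cs
  control (branch b p q) (just (inj₁ x)) cs = map₁ (mapᴹ (just ∘ inj₁)) (control p x cs)
  control (branch b p q) (just (inj₂ y)) cs = map₁ (mapᴹ (just ∘ inj₂)) (control q y cs)
  control (while b p) nothing  cs = (if b (mapᵛ symbol cs) then just (just (entry p)) else nothing) , idle cs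
  control (while b p) (just x) cs = map₁ just (control p x cs)

  module Compiled (main : Prog n) (accept : Tops n → Bool) where

    -- `inj₂ nothing` is the one transition between the program and the verdict: it reads the tops
    -- left by `main` and commits to a final state.
    State : Set
    State = Point main ⊎ Maybe Bool

    afterMain : Maybe (Point main) → State
    afterMain = maybe inj₁ (inj₂ nothing)

    final : State → Bool
    final (inj₂ (just _)) = true
    final _               = false

    transition : State → Vec Cell n → State × Actions n
    transition (inj₁ x) cs = map₁ afterMain (control main x cs)
    transition (inj₂ _) cs = inj₂ (just (accept (mapᵛ symbol cs))) , idle cs

    machine : TM Symbol n
    machine = record
      { Work         = ⊥
      ; Work-finite  = ⊥-finite
      ; State        = State
      ; State-finite = ⊎-finite (Point-finite main) (Maybe-finite Bool-finite)
      ; start        = inj₁ (entry main)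
      ; final        = final
      ; δ            = transition
      }

    Tapes : Set
    Tapes = Vec (Tape Cell) n

    actᴹ : Cell × Move → Tape Cell → Tape Cell
    actᴹ = act machine

    heads : Tapes → Vec Cell n
    heads = mapᵛ Tape.head

    infix 4 _≈_

    _≈_ : Tapes → Stacks n → Set
    _≈_ = Pointwise (λ T w → Holds machine w T)

    head-symbol : ∀ {T w} → Holds machine w T → symbol (Tape.head T) ≡ head w
    head-symbol {w = []}    (_ , suc m , refl) = refl
    head-symbol {w = c ∷ w} (_ , m     , refl) = refl

    heads-tops : ∀ {k} {Ts : Vec (Tape Cell) k} {σ} → Pointwise (λ T w → Holds machine w T) Ts σ →
                 mapᵛ symbol (mapᵛ Tape.head Ts) ≡ tops σ
    heads-tops []                = refl
    heads-tops (_∷_ {x = T} {y = w} h hs) = cong₂ _∷_ (head-symbol {T} {w} h) (heads-tops hs)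

    -- The erased cell joins the blanks on the left. On an empty stack the head merely moves to
    -- another blank, in agreement with `drop 1`.
    pop-holds : ∀ {T w} → Holds machine w T → Holds machine (drop 1 w) (actᴹ (nothing , right) T)
    pop-holds {w = []}        (ls , suc zero    , refl) = refl ∷ ls , 1 , refl
    pop-holds {w = []}        (ls , suc (suc m) , refl) = refl ∷ ls , suc m , refl
    pop-holds {w = c ∷ []}    (ls , zero        , refl) = refl ∷ ls , 1 , refl
    pop-holds {w = c ∷ []}    (ls , suc m       , refl) = refl ∷ ls , suc m , refl
    pop-holds {w = c ∷ d ∷ w} (ls , m           , refl) = refl ∷ ls , m , refl

    -- The cell to the left of the head is blank, whether listed or fresh, so it is free to take the
    -- new top.
    push-holds : ∀ {T w} c → Holds machine w T →
                 Holds machine (c ∷ w) (actᴹ (just (inj₁ c) , stay) (actᴹ (Tape.head T , left) T))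
    push-holds {T = [] ◂ _ ▸ _}    c ([]      , m , e) = [] , m , cong (just (inj₁ c) ∷_) e
    push-holds {T = (_ ∷ _) ◂ _ ▸ _} c (_ ∷ ls , m , e) = ls , m , cong (just (inj₁ c) ∷_) e

    perform : Actions n → Tapes → Tapes
    perform = zipWith actᴹ

    perform-idle : ∀ {k} (Ts : Vec (Tape Cell) k) → zipWith actᴹ (idle (mapᵛ Tape.head Ts)) Ts ≡ Ts
    perform-idle []       = refl
    perform-idle (T ∷ Ts) = cong (T ∷_) (perform-idle Ts)

    perform-at : ∀ {k} i a (Ts : Vec (Tape Cell) k) →
                 zipWith actᴹ (at i a (mapᵛ Tape.head Ts)) Ts ≡ updateAt Ts i (actᴹ a)
    perform-at zero    a (T ∷ Ts) = cong (actᴹ a T ∷_) (perform-idle Ts)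
    perform-at (suc i) a (T ∷ Ts) = cong (T ∷_) (perform-at i a Ts)

    ≈-updateAt : ∀ {k} i {f g} {Ts : Vec (Tape Cell) k} {σ} →
                 (∀ {T w} → Holds machine w T → Holds machine (g w) (f T)) →
                 Pointwise (λ T w → Holds machine w T) Ts σ →
                 Pointwise (λ T w → Holds machine w T) (updateAt Ts i f) (updateAt σ i g)
    ≈-updateAt zero    fg (_∷_ {x = T} {y = w} h hs) = fg {T} {w} h ∷ hs
    ≈-updateAt (suc i) fg (h ∷ hs) = h ∷ ≈-updateAt i fg hs

    push-at : ∀ {k} i c (Ts : Vec (Tape Cell) k) →
              let Ts′ = zipWith actᴹ (at i (lookup (mapᵛ Tape.head Ts) i , left) (mapᵛ Tape.head Ts)) Ts in
              zipWith actᴹ (at i (just (inj₁ c) , stay) (mapᵛ Tape.head Ts′)) Ts′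
              ≡ updateAt Ts i (λ T → actᴹ (just (inj₁ c) , stay) (actᴹ (Tape.head T , left) T))
    push-at zero    c (T ∷ Ts) rewrite perform-idle Ts | perform-idle Ts = refl
    push-at (suc i) c (T ∷ Ts) = cong (T ∷_) (push-at i c Ts)

    data Run (p : Prog n) : Point p → Tapes → ℕ → Tapes → Set where
      exit : ∀ {x Ts as} → control p x (heads Ts) ≡ (nothing , as) → Run p x Ts (suc t) (perform as Ts)
      step : ∀ {x y Ts as Ts′} → control p x (heads Ts) ≡ (just y , as) →
             Run p y (perform as Ts) t Ts′ → Run p x Ts (suc t) Ts′

    private variable
      Ts Ts′ Ts″ : Tapes

    Run-weaken : ∀ {x} → t ≤ u → Run p x Ts t Ts′ → Run p x Ts u Ts′
    Run-weaken (s≤s _)   (exit e)   = exit e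
    Run-weaken (s≤s t≤u) (step e r) = step e (Run-weaken t≤u r)

    Run-seqʳ : ∀ {y} → Run q y Ts t Ts′ → Run (p ⨟ q) (inj₂ y) Ts t Ts′
    Run-seqʳ (exit e)   = exit (cong (map₁ (mapᴹ inj₂)) e)
    Run-seqʳ (step e r) = step (cong (map₁ (mapᴹ inj₂)) e) (Run-seqʳ r)

    -- The transition that exits `p` leads straight to the entry of `q`, so composition costs no
    -- step of its own.
    Run-seq : ∀ {x} → Run p x Ts t Ts′ → Run q (entry q) Ts′ u Ts″ → Run (p ⨟ q) (inj₁ x) Ts (t + u) Ts″
    Run-seq {q = q} (exit {t = t} e) r = step (cong (map₁ (just ∘ maybe inj₁ (inj₂ (entry q)))) e) (Run-weaken (m≤n+m _ t) (Run-seqʳ r))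
    Run-seq {q = q} (step e r) r′ = step (cong (map₁ (just ∘ maybe inj₁ (inj₂ (entry q)))) e) (Run-seq r r′)

    Run-then : ∀ {x} → Run p x Ts t Ts′ → Run (branch b p q) (just (inj₁ x)) Ts t Ts′
    Run-then (exit e)   = exit (cong (map₁ (mapᴹ (just ∘ inj₁))) e)
    Run-then (step e r) = step (cong (map₁ (mapᴹ (just ∘ inj₁))) e) (Run-then r)

    Run-else : ∀ {y} → Run q y Ts t Ts′ → Run (branch b p q) (just (inj₂ y)) Ts t Ts′
    Run-else (exit e)   = exit (cong (map₁ (mapᴹ (just ∘ inj₂))) e)
    Run-else (step e r) = step (cong (map₁ (mapᴹ (just ∘ inj₂))) e) (Run-else r)

    Run-again : ∀ {x} → Run p x Ts t Ts′ → Run (while b p) nothing Ts′ u Ts″ →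
                Run (while b p) (just x) Ts (t + u) Ts″
    Run-again (exit {t = t} e) r = step (cong (map₁ just) e) (Run-weaken (m≤n+m _ t) r)
    Run-again (step e r) r′ = step (cong (map₁ just) e) (Run-again r r′)

    -- Tests leave the tapes alone, but `perform` of idle actions is the identity only up to a
    -- proved equation.
    idly : ∀ {x y} → control p x (heads Ts) ≡ (just y , idle (heads Ts)) →
           Run p y Ts t Ts′ → Run p x Ts (suc t) Ts′
    idly {Ts = Ts} {t = t} {Ts′ = Ts′} e r = step e (transport (perform-idle Ts) r)
      where
      transport : ∀ {S S′ x} → S ≡ S′ → Run p x S′ t Ts′ → Run p x S t Ts′
      transport refl r = r

    ⇓-Run : p ⊢ σ ⇓[ t ] σ′ → Ts ≈ σ → ∃[ Ts′ ] Run p (entry p) Ts t Ts′ × Ts′ ≈ σ′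
    ⇓-Run {Ts = Ts} (pop {i = i}) h = _ , exit refl , result
      where
      result : perform (at i (nothing , right) (heads Ts)) Ts ≈ updateAt _ i (drop 1)
      result rewrite perform-at i (nothing , right) Ts = ≈-updateAt i (λ {T} {w} → pop-holds {T} {w}) h
    ⇓-Run {Ts = Ts} (push {i = i} {f = f} {σ = σ}) h =
      _ , step refl (exit refl) , result
      where
      c = f (mapᵛ symbol (heads Ts))
      Ts₁ = perform (at i (lookup (heads Ts) i , left) (heads Ts)) Ts
      result : perform (at i (just (inj₁ c) , stay) (heads Ts₁)) Ts₁ ≈ updateAt σ i (f (tops σ) ∷_)
      result rewrite push-at i c Ts | sym (heads-tops h) = ≈-updateAt i (λ {T} {w} → push-holds {T} {w} c) h
    ⇓-Run (d ⨟ d′) h =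
      let Ts₁ , r , h₁ = ⇓-Run d h ; Ts₂ , r′ , h₂ = ⇓-Run d′ h₁ in Ts₂ , Run-seq r r′ , h₂
    ⇓-Run {p = branch b p q} {Ts = Ts} (thenᵇ e d) h =
      let Ts₁ , r , h₁ = ⇓-Run d h in
      Ts₁ , idly (cong (λ v → just (just (if v then inj₁ (entry p) else inj₂ (entry q))) , idle (heads Ts))
                       (trans (cong b (heads-tops h)) e)) (Run-then r) , h₁
    ⇓-Run {p = branch b p q} {Ts = Ts} (elseᵇ e d) h =
      let Ts₁ , r , h₁ = ⇓-Run d h in
      Ts₁ , idly (cong (λ v → just (just (if v then inj₁ (entry p) else inj₂ (entry q))) , idle (heads Ts))
                       (trans (cong b (heads-tops h)) e)) (Run-else r) , h₁
    ⇓-Run {p = while b p} {Ts = Ts} (again e d d′) h =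
      let Ts₁ , r , h₁ = ⇓-Run d h ; Ts₂ , r′ , h₂ = ⇓-Run d′ h₁ in
      Ts₂ , idly (cong (λ v → (if v then just (just (entry p)) else nothing) , idle (heads Ts))
                       (trans (cong b (heads-tops h)) e)) (Run-again r r′) , h₂
    ⇓-Run {p = while b p} {Ts = Ts} (leave e) h =
      _ , exit (cong (λ v → (if v then just (just (entry p)) else nothing) , idle (heads Ts))
                     (trans (cong b (heads-tops h)) e)) , result
      where
      result : perform (idle (heads Ts)) Ts ≈ _
      result rewrite perform-idle Ts = h
    ⇓-Run (weaken t≤u d) h = let Ts₁ , r , h₁ = ⇓-Run d h in Ts₁ , Run-weaken t≤u r , h₁

    Run-run : ∀ {x} → Run main x Ts t Ts′ →
              ∃[ i ] i ≤ t × run machine i (inj₁ x , Ts) ≡ (inj₂ nothing , Ts′)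
    Run-run {Ts = Ts} {x = x} (exit {as = as} e) = 1 , s≤s z≤n ,
      cong (λ r → afterMain (proj₁ r) , perform (proj₂ r) Ts) e
    Run-run {Ts = Ts} {x = x} (step e r) =
      let i , i≤t , e′ = Run-run r in
      suc i , s≤s i≤t ,
      trans (cong (λ r → run machine i (afterMain (proj₁ r) , perform (proj₂ r) Ts)) e) e′

    run-+ : ∀ i j c → run machine (i + j) c ≡ run machine j (run machine i c)
    run-+ zero    j c = refl
    run-+ (suc i) j c = run-+ i j (next machine c)

    verdict : main ⊢ σ ⇓[ t ] σ′ → Ts ≈ σ →
              ∃[ i ] ∃[ Ts′ ] i ≤ suc t × Ts′ ≈ σ′ ×
              run machine i (TM.start machine , Ts) ≡ (inj₂ (just (accept (tops σ′))) , Ts′)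
    verdict {σ = σ} {t = t} {σ′ = σ′} {Ts = Ts} d h =
      let Ts′ , r , h′ = ⇓-Run d h ; i , i≤t , e = Run-run r in
      i + 1 , Ts′ , ≤-trans (+-monoˡ-≤ 1 i≤t) (≤-reflexive (+-comm t 1)) , h′ ,
      trans (run-+ i 1 (TM.start machine , Ts))
        (trans (cong (next machine) e)
          (cong₂ _,_ (cong (inj₂ ∘ just ∘ accept) (heads-tops h′)) (perform-idle Ts′)))

    haltsWith : ∀ Q i {c c′} → run machine i c ≡ c′ → Halted machine c′ → Q c′ → HaltsWith machine Q c
    haltsWith Q i refl h q = i , h , q

    tapeSize-act : ∀ a T → tapeSize machine (actᴹ a T) ≤ suc (tapeSize machine T)
    tapeSize-act (_ , stay)  _                  = n≤1+n _
    tapeSize-act (_ , left)  ([] ◂ _ ▸ _)       = ≤-refl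
    tapeSize-act (_ , left)  ((_ ∷ ls) ◂ _ ▸ rs) = ≤-trans (≤-reflexive (+-suc (length ls + 1) (length rs))) (n≤1+n _)
    tapeSize-act (_ , right) (_ ◂ _ ▸ [])       = ≤-refl
    tapeSize-act (_ , right) (ls ◂ _ ▸ (_ ∷ rs)) =
      ≤-trans (≤-reflexive (sym (+-suc (length ls + 1) (length rs)))) (n≤1+n _)

    sum-perform : ∀ {k} (as : Actions k) (Ts : Vec (Tape Cell) k) →
                  sumᵛ (mapᵛ (tapeSize machine) (zipWith actᴹ as Ts)) ≤ k + sumᵛ (mapᵛ (tapeSize machine) Ts)
    sum-perform []       []       = z≤n
    sum-perform {suc k} (a ∷ as) (T ∷ Ts) = begin
      tapeSize machine (actᴹ a T) + sumᵛ (mapᵛ (tapeSize machine) (zipWith actᴹ as Ts))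
        ≤⟨ +-mono-≤ (tapeSize-act a T) (sum-perform as Ts) ⟩
      suc (tapeSize machine T + (k + sumᵛ (mapᵛ (tapeSize machine) Ts)))
        ≡⟨ cong suc (sym (+-assoc (tapeSize machine T) k _)) ⟩
      suc (tapeSize machine T + k + sumᵛ (mapᵛ (tapeSize machine) Ts))
        ≡⟨ cong (λ m → suc (m + sumᵛ (mapᵛ (tapeSize machine) Ts))) (+-comm (tapeSize machine T) k) ⟩
      suc (k + tapeSize machine T + sumᵛ (mapᵛ (tapeSize machine) Ts))
        ≡⟨ cong suc (+-assoc k (tapeSize machine T) _) ⟩
      suc k + (tapeSize machine T + sumᵛ (mapᵛ (tapeSize machine) Ts)) ∎
      where open ≤-Reasoning

    size-next : ∀ c → size machine (next machine c) ≤ n + size machine c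
    size-next (q , Ts) with final q
    ... | true  = m≤n+m _ n
    ... | false = sum-perform (proj₂ (transition q (heads Ts))) Ts

    size-run : ∀ i c → size machine (run machine i c) ≤ i * n + size machine c
    size-run zero    c = ≤-refl
    size-run (suc i) c = begin
      size machine (run machine i (next machine c)) ≤⟨ size-run i (next machine c) ⟩
      i * n + size machine (next machine c)         ≤⟨ +-monoʳ-≤ (i * n) (size-next c) ⟩
      i * n + (n + size machine c)                  ≡⟨ sym (+-assoc (i * n) n _) ⟩
      i * n + n + size machine c                    ≡⟨ cong (_+ size machine c) (+-comm (i * n) n) ⟩
      n + i * n + size machine c                    ∎
      where open ≤-Reasoning

    run-halted : ∀ j c → Halted machine c → run machine j c ≡ c
    run-halted zero    c h = refl
    run-halted (suc j) (q , Ts) h = trans (cong (run machine j) halted) (run-halted j (q , Ts) h)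
      where
      halted : next machine (q , Ts) ≡ (q , Ts)
      halted rewrite h = refl

    -- One step enlarges each of the n tapes by at most one cell, and a halted configuration no
    -- longer changes; a time bound is thus a space bound for the infinite run.
    halts⇒space : ∀ {i c} → i ≤ t → Halted machine (run machine i c) →
                  SpaceWithin machine (t * n + size machine c) c
    halts⇒space {t = t} {i = i} {c} i≤t h j with ≤-total j i
    ... | inj₁ j≤i = ≤-trans (size-run j c) (+-monoˡ-≤ (size machine c) (*-monoˡ-≤ n (≤-trans j≤i i≤t)))
    ... | inj₂ i≤j with m≤n⇒∃[o]m+o≡n i≤j
    ...   | o , refl rewrite run-+ i o c | run-halted o (run machine i c) h =
      ≤-trans (size-run i c) (+-monoˡ-≤ (size machine c) (*-monoˡ-≤ n i≤t))

open StackMachine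

-- The heap machine: correctness and exact number of steps

module HeapMachine where

  open import Data.List.Relation.Binary.Pointwise.Base using (Pointwise; []; _∷_)
  import Data.List.Relation.Binary.Pointwise as Pw

  private variable
    s s′ t t′ u : Term
    H : Heap
    a b k n i j : ℕ
    g : Closure
    P Q : Program
    S S₁ S₂ : List Term
    T V : List Closure

  abstraction-normal : Abstraction s → ¬ s ≻ t
  abstraction-normal (_ , refl) ()

  ≻-deterministic : s ≻ t → s ≻ t′ → t ≡ t′
  ≻-deterministic β      β      = refl
  ≻-deterministic (ξₗ r) (ξₗ q) = cong (_· _) (≻-deterministic r q)
  ≻-deterministic (ξᵣ r) (ξᵣ q) = cong (_ ·_) (≻-deterministic r q)

  ≻^-snoc : s ≻^[ j ] t → t ≻ u → s ≻^[ suc j ] u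
  ≻^-snoc done       q = step q done
  ≻^-snoc (step r d) q = step r (≻^-snoc d q)

  -- By determinism every reduction sequence from `s` is a prefix of the one to the normal form.
  ≻^-normal : s ≻^[ i ] t → Abstraction t → s ≻^[ j ] u → ∃[ o ] j + o ≡ i × u ≻^[ o ] t
  ≻^-normal d          at done       = _ , refl , d
  ≻^-normal done       at (step q e) = contradiction q (abstraction-normal at)
  ≻^-normal (step r d) at (step q e) with ≻-deterministic r q
  ... | refl = let o , eq , d′ = ≻^-normal d at e in o , cong suc eq , d′

  normal-unique : s ≻^[ i ] t → Abstraction t → s ≻^[ j ] u → Abstraction u → i ≡ j × t ≡ u
  normal-unique {j = j} d at e au with ≻^-normal d at e
  ... | zero  , refl , done     = +-identityʳ j , refl
  ... | suc o , eq   , step r _ = contradiction r (abstraction-normal au)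

  entry-snoc : ∀ {e e′} H a → H [ a ] ≡ just e → (H ++ e′ ∷ []) [ a ] ≡ just e
  entry-snoc (_ ∷ H) (suc zero)    eq = eq
  entry-snoc (_ ∷ H) (suc (suc a)) eq = entry-snoc H (suc a) eq

  lookup-snoc : ∀ {e} H a n → H [ a ∙ n ] ≡ just g → (H ++ e ∷ []) [ a ∙ n ] ≡ just g
  lookup-snoc {e = e} H a zero eq with H [ a ] in eqₐ
  ... | just x rewrite entry-snoc {e′ = e} H a eqₐ = eq
  lookup-snoc {e = e} H a (suc n) eq with H [ a ] in eqₐ
  ... | just (_ , b) rewrite entry-snoc {e′ = e} H a eqₐ = lookup-snoc H b n eq

  entry-last : ∀ H {e} → (H ++ e ∷ []) [ suc (length H) ] ≡ just e
  entry-last []      = refl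
  entry-last (x ∷ H) = entry-last H

  unfold-snoc : ∀ {e} → ⟨ u , a ⟩▷[ H , k ] s → ⟨ u , a ⟩▷[ H ++ e ∷ [] , k ] s
  unfold-snoc (bound n<k) = bound n<k
  unfold-snoc {a = a} {H = H} (free {n = n} {k = k} k≤n eq P d) =
    free k≤n (lookup-snoc H a (n ∸ k) eq) P (unfold-snoc d)
  unfold-snoc (ƛ d)   = ƛ unfold-snoc d
  unfold-snoc (d · e) = unfold-snoc d · unfold-snoc e

  ≫-snoc : ∀ {e} → g ≫[ H ] s → g ≫[ H ++ e ∷ [] ] s
  ≫-snoc (u , P , d) = u , P , unfold-snoc d

  bound-≤ : k ≤ n → Bound k s → Bound n s
  bound-≤ k≤n (` i<k) = ` <-≤-trans i<k k≤n
  bound-≤ k≤n (d · e) = bound-≤ k≤n d · bound-≤ k≤n e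
  bound-≤ k≤n (ƛ d)   = ƛ bound-≤ (s≤s k≤n) d

  -- An index of at least k is replaced by an unfolding at depth 0, which is closed; only bound
  -- indices survive.
  unfold-bound : ⟨ u , a ⟩▷[ H , k ] s → Bound k s
  unfold-bound (bound n<k)    = ` n<k
  unfold-bound (free _ _ _ d) = bound-≤ z≤n (unfold-bound d)
  unfold-bound (ƛ d)          = ƛ unfold-bound d
  unfold-bound (d · e)        = unfold-bound d · unfold-bound e

  subst-bound : Bound k s → k ≤ n → subst s n u ≡ s
  subst-bound {n = n} (`_ {i} i<k) k≤n
    rewrite dec-false (i ≟ n) (λ { refl → n≮n i (<-≤-trans i<k k≤n) }) = refl
  subst-bound (d · e) k≤n = cong₂ _·_ (subst-bound d k≤n) (subst-bound e k≤n)
  subst-bound (ƛ d)   k≤n = cong ƛ_ (subst-bound d (s≤s k≤n))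

  closed-unfold : Bound k s → ⟨ s , a ⟩▷[ H , k ] s
  closed-unfold (` n<k) = bound n<k
  closed-unfold (d · e) = closed-unfold d · closed-unfold e
  closed-unfold (ƛ d)   = ƛ closed-unfold d

  lookup-zero : ∀ H a {g b} → H [ a ] ≡ just (g , b) → H [ a ∙ 0 ] ≡ just g
  lookup-zero H a eq rewrite eq = refl

  lookup-suc : ∀ H a n {g b} → H [ a ] ≡ just (g , b) → H [ a ∙ suc n ] ≡ H [ b ∙ n ]
  lookup-suc H a n eq rewrite eq = refl

  -- Substituting the argument is extending the environment.
  unfold-subst : ∀ {H u k s a b g t} → ⟨ u , b ⟩▷[ H , suc k ] s → H [ a ] ≡ just (g , b) → g ≫[ H ] t →
                 ⟨ u , a ⟩▷[ H , k ] subst s k t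
  unfold-subst {H} {k = k} {a = a} (bound {n} n≤k) eqₐ (v , P , d) with n ≟ k
  ... | yes refl rewrite dec-true (n ≟ n) refl = free ≤-refl (trans (cong (H [ a ∙_]) (n∸n≡0 n)) (lookup-zero H a eqₐ)) P d
  ... | no n≢k rewrite dec-false (n ≟ k) n≢k = bound (≤∧≢⇒< (≤-pred n≤k) n≢k)
  -- An index above k steps past the new entry and continues in `b`; what it unfolds to is closed,
  -- so the substitution leaves it alone.
  unfold-subst {H} {k = k} {a = a} {b} {t = t} (free {n = n} {s′ = s} k<n eq P d) eqₐ _
    rewrite subst-bound {n = k} {u = t} (unfold-bound d) z≤n =
    free (<⇒≤ k<n) (trans (cong (H [ a ∙_]) (sym (m∸n≡sucm∸sucn k<n)))
                           (trans (lookup-suc H a (n ∸ suc k) eqₐ) eq)) P d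
    where
    m∸n≡sucm∸sucn : ∀ {k n} → k < n → suc (n ∸ suc k) ≡ n ∸ k
    m∸n≡sucm∸sucn {k} {n} k<n = sym (+-∸-assoc 1 k<n)
  unfold-subst (ƛ d)   eqₐ g = ƛ unfold-subst d eqₐ g
  unfold-subst (d · e) eqₐ g = unfold-subst d eqₐ g · unfold-subst e eqₐ g

  record HeapState : Set where
    constructor ⟪_,_,_⟫
    field
      tasks  : List Closure
      values : List Closure
      heap   : Heap

  open HeapState public

  infix 4 _⟶_

  -- The matching `ret` of a `lam` is given by the shape `γ u ++ ret ∷ P` instead of by a parser.
  data _⟶_ : HeapState → HeapState → Set where
    nil : ⟪ ([] , a) ∷ T , V , H ⟫ ⟶ ⟪ T , V , H ⟫
    var : H [ a ∙ n ] ≡ just g → ⟪ (var n ∷ P , a) ∷ T , V , H ⟫ ⟶ ⟪ (P , a) ∷ T , g ∷ V , H ⟫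
    lam : ⟪ (lam ∷ γ u ++ ret ∷ P , a) ∷ T , V , H ⟫ ⟶ ⟪ (P , a) ∷ T , (γ u , a) ∷ V , H ⟫
    app : ⟪ (app ∷ P , a) ∷ T , g ∷ (Q , b) ∷ V , H ⟫ ⟶
          ⟪ (Q , suc (length H)) ∷ (P , a) ∷ T , V , H ++ (g , b) ∷ [] ⟫

  -- Executing P in the environment a symbolically, without reduction, turns
  -- the stack S of terms into S′.
  data Exec (H : Heap) (a : Address) : Program → List Term → List Term → Set where
    nil : Exec H a [] S S
    var : H [ a ∙ n ] ≡ just g → g ≫[ H ] s → Exec H a P (s ∷ S) S₁ → Exec H a (var n ∷ P) S S₁
    lam : ⟨ ƛ u , a ⟩▷[ H , 0 ] s → Exec H a P (s ∷ S) S₁ → Exec H a (lam ∷ γ u ++ ret ∷ P) S S₁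
    app : Exec H a P (s · t ∷ S) S₁ → Exec H a (app ∷ P) (t ∷ s ∷ S) S₁

  data Execs (H : Heap) : List Closure → List Term → List Term → Set where
    []  : Execs H [] S S
    _∷_ : Exec H a P S S₁ → Execs H T S₁ S₂ → Execs H ((P , a) ∷ T) S S₂

  -- Each reduct is obtained inside one stack cell above abstractions only.
  data _≻ˢ_ : List Term → List Term → Set where
    here  : All Abstraction S → s ≻ s′ → (s ∷ S) ≻ˢ (s′ ∷ S)
    there : S₁ ≻ˢ S₂ → (t ∷ S₁) ≻ˢ (t ∷ S₂)

  -- A reduction made now is a reduction of the term assembled later. When `app` joins two cells, a
  -- step in the function lifts by `ξₗ`, but a step in the argument lifts by `ξᵣ` only if the cell
  -- below is an abstraction; this is why `here` asks for abstractions below.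
  Exec-≻ : Exec H a P S S₁ → S ≻ˢ S₂ → ∃[ S₃ ] S₁ ≻ˢ S₃ × Exec H a P S₂ S₃
  Exec-≻ nil r = _ , r , nil
  Exec-≻ (var eq g d) r = let _ , r′ , d′ = Exec-≻ d (there r) in _ , r′ , var eq g d′
  Exec-≻ (lam u d) r = let _ , r′ , d′ = Exec-≻ d (there r) in _ , r′ , lam u d′
  Exec-≻ (app d) (here ((_ , refl) ∷ as) r) =
    let _ , r′ , d′ = Exec-≻ d (here as (ξᵣ r)) in _ , r′ , app d′
  Exec-≻ (app d) (there (here as r)) = let _ , r′ , d′ = Exec-≻ d (here as (ξₗ r)) in _ , r′ , app d′
  Exec-≻ (app d) (there (there r)) = let _ , r′ , d′ = Exec-≻ d (there r) in _ , r′ , app d′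

  Execs-≻ : Execs H T S S₁ → S ≻ˢ S₂ → ∃[ S₃ ] S₁ ≻ˢ S₃ × Execs H T S₂ S₃
  Execs-≻ []       r = _ , r , []
  Execs-≻ (d ∷ ds) r =
    let _ , r₁ , d′ = Exec-≻ d r ; _ , r₂ , ds′ = Execs-≻ ds r₁ in _ , r₂ , d′ ∷ ds′

  Exec-snoc : ∀ {e} → Exec H a P S S₁ → Exec (H ++ e ∷ []) a P S S₁
  Exec-snoc nil = nil
  Exec-snoc {H = H} {a = a} (var {n = n} eq g d) = var (lookup-snoc H a n eq) (≫-snoc g) (Exec-snoc d)
  Exec-snoc (lam u d) = lam (unfold-snoc u) (Exec-snoc d)
  Exec-snoc (app d) = app (Exec-snoc d)

  Execs-snoc : ∀ {e} → Execs H T S S₁ → Execs (H ++ e ∷ []) T S S₁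
  Execs-snoc []       = []
  Execs-snoc (d ∷ ds) = Exec-snoc d ∷ Execs-snoc ds

  -- The bridge from unfolding to symbolic execution. The continuation `P` is arbitrary so that the
  -- induction passes through applications.
  Exec-γ : ∀ u {P} → ⟨ u , a ⟩▷[ H , 0 ] s → Exec H a P (s ∷ S) S₁ → Exec H a (γ u ++ P) S S₁
  Exec-γ (` n) (free _ eq P d) e = var eq (_ , P , d) e
  Exec-γ (u · v) {P} (d · d′) e
    rewrite ++-assoc (γ u) (γ v ++ app ∷ []) P | ++-assoc (γ v) (app ∷ []) P =
    Exec-γ u d (Exec-γ v d′ (app e))
  Exec-γ (ƛ u) {P} d@(ƛ _) e rewrite ++-assoc (γ u) (ret ∷ []) P = lam d e

  ≫-abstraction : g ≫[ H ] s → Abstraction s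
  ≫-abstraction (_ , (_ , _ , refl) , ƛ _) = _ , refl

  values-abstractions : Pointwise (_≫[ H ]_) V S → All Abstraction S
  values-abstractions []       = []
  values-abstractions (g ∷ gs) = ≫-abstraction g ∷ values-abstractions gs

  -- The invariant of the simulation: started on the unfolded values, the tasks assemble exactly one
  -- term.
  Represents : HeapState → Term → Set
  Represents ⟪ T , V , H ⟫ s = ∃[ S ] Pointwise (_≫[ H ]_) V S × Execs H T S (s ∷ [])

  -- Each closure counts as one more command, so that `nil` also decreases the measure.
  commands : List Closure → ℕ
  commands []            = 0
  commands ((P , _) ∷ T) = suc (length P) + commands T

  data Step (σ : HeapState) (s : Term) : Set where
    silent : ∀ {σ′} → σ ⟶ σ′ → Represents σ′ s → commands (tasks σ′) < commands (tasks σ) →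
             length (tasks σ) + length (values σ′) ≡ 1 + length (tasks σ′) + length (values σ) →
             Step σ s
    beta   : ∀ {σ′ s′} → σ ⟶ σ′ → s ≻ s′ → Represents σ′ s′ →
             length (tasks σ′) ≡ 1 + length (tasks σ) → length (values σ) ≡ 2 + length (values σ′) →
             Step σ s

  -- The symbolic run already contains whatever the next rule requires, be it a defined lookup, a
  -- delimited body or two values, so the machine cannot be stuck.
  progress : ∀ {h T V H s} → Represents ⟪ h ∷ T , V , H ⟫ s → Step ⟪ h ∷ T , V , H ⟫ s
  progress {T = T} {V} (S , vs , (nil ∷ ds)) =
    silent nil (S , vs , ds) ≤-refl refl
  progress {T = T} {V} (S , vs , (var {P = P} eq g d ∷ ds)) =
    silent (var eq) (_ , g ∷ vs , d ∷ ds) ≤-refl (+-suc (suc (length T)) (length V))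
  progress {T = T} {V} (S , vs , (lam {u = u} {P = P} d e ∷ ds)) =
    silent (lam {u = u}) (_ , (_ , (_ , refl , refl) , d) ∷ vs , e ∷ ds)
      (s≤s (s≤s (+-monoˡ-≤ (commands T) (≤-trans (m≤n+m (length P) (suc (length (γ u))))
        (≤-reflexive (trans (sym (+-suc (length (γ u)) (length P))) (sym (length-++ (γ u)))))))))
      (+-suc (suc (length T)) (length V))
  progress {T = T} {H = H} (_ , _∷_ {x = g} gt (_∷_ {x = Q , b} (_ , (u , refl , refl) , ƛ d) vs) , (app {P = P} e ∷ ds))
    with ≫-abstraction gt
  ... | w , refl =
    -- The redex is the topmost cell and only values, hence abstractions, lie below it. The
    -- contraction passes through the rest of `P` and then through the other tasks.
    let _ , r , e′ = Exec-≻ e (here (values-abstractions vs) β)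
        _ , r′ , ds′ = Execs-≻ ds r
        s , r″ , ds″ = single r′ ds′
    in
    beta app r″
      (_ , Pw.map ≫-snoc vs ,
        -- Run at the fresh address, the body yields the contractum, since the new entry acts as the
        -- substitution.
        (≡-Exec (++-identityʳ (γ u)) (Exec-γ u (unfold-subst (unfold-snoc d) (entry-last H) (≫-snoc gt)) nil)
        ∷ Exec-snoc e′ ∷ Execs-snoc ds″))
      refl refl
    where
    single : ∀ {s S S₁} → (s ∷ []) ≻ˢ S₁ → Execs H T S S₁ → ∃[ s′ ] s ≻ s′ × Execs H T S (s′ ∷ [])
    single (here [] r) ds = _ , r , ds
    ≡-Exec : ∀ {H a P P′ S S₁} → P ≡ P′ → Exec H a P S S₁ → Exec H a P′ S S₁
    ≡-Exec refl e = e

  initial : Term → HeapState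
  initial s = ⟪ (γ s , 0) ∷ [] , [] , [] ⟫

  initial-represents : Closed s → Represents (initial s) s
  initial-represents {s} c = [] , [] , (exec ∷ [])
    where
    exec : Exec [] 0 (γ s) [] (s ∷ [])
    exec with Exec-γ {H = []} {S = []} s {[]} (closed-unfold c) nil
    ... | e rewrite ++-identityʳ (γ s) = e

  -- The count holds because every step but app removes a task or adds a value,
  -- whereas app adds a task and removes two values.
  record Reached (s : Term) (m : ℕ) (σ : HeapState) : Set where
    constructor reached
    field
      {time}     : ℕ
      {term}     : Term
      reduces    : s ≻^[ time ] term
      represents : Represents σ term
      count      : m + length (tasks σ) ≡ 4 * time + 1 + length (values σ)

  open Reached public

  reached-initial : Closed s → Reached s 0 (initial s)
  reached-initial c = reached done (initial-represents c) refl

  reached-step : ∀ {s m h T V H} (r : Reached s m ⟪ h ∷ T , V , H ⟫) →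
                 ∃[ σ ] ⟪ h ∷ T , V , H ⟫ ⟶ σ × Σ[ r′ ∈ Reached s (suc m) σ ]
                   (term r ≡ term r′ × commands (tasks σ) < commands (h ∷ T) ⊎ term r ≻ term r′)
  reached-step {m = m} {T = T} {V} (reached {j} d rep count) with progress rep
  ... | silent {⟪ T′ , V′ , _ ⟫} r rep′ less eq = _ , r , reached d rep′ (+-cancelʳ-≡ (length V) _ _ (begin
      suc m + length T′ + length V     ≡⟨ solve 3 (λ m t v → con 1 :+ m :+ t :+ v := m :+ (con 1 :+ t :+ v)) refl m (length T′) (length V) ⟩
      m + (1 + length T′ + length V)   ≡⟨ cong (m +_) (sym eq) ⟩
      m + (suc (length T) + length V′) ≡⟨ sym (+-assoc m _ _) ⟩
      m + suc (length T) + length V′   ≡⟨ cong (_+ length V′) count ⟩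
      4 * j + 1 + length V + length V′ ≡⟨ solve 3 (λ j v w → j :+ v :+ w := j :+ w :+ v) refl (4 * j + 1) (length V) (length V′) ⟩
      4 * j + 1 + length V′ + length V ∎)) , inj₁ (refl , less)
    where open ≡-Reasoning
          open +-*-Solver
  ... | beta {⟪ T′ , V′ , _ ⟫} r q rep′ eqT eqV = _ , r , reached (≻^-snoc d q) rep′ (begin
      suc m + length T′                 ≡⟨ cong (suc m +_) eqT ⟩
      suc m + suc (suc (length T))      ≡⟨ solve 2 (λ m t → con 1 :+ m :+ (con 2 :+ t) := con 2 :+ (m :+ (con 1 :+ t))) refl m (length T) ⟩
      2 + (m + suc (length T))          ≡⟨ cong (2 +_) count ⟩
      2 + (4 * j + 1 + length V)        ≡⟨ cong (λ v → 2 + (4 * j + 1 + v)) eqV ⟩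
      2 + (4 * j + 1 + (2 + length V′)) ≡⟨ solve 2 (λ j v → con 2 :+ (con 4 :* j :+ con 1 :+ (con 2 :+ v)) := con 4 :* (con 1 :+ j) :+ con 1 :+ v) refl j (length V′) ⟩
      4 * suc j + 1 + length V′         ∎) , inj₂ q
    where open ≡-Reasoning
          open +-*-Solver

  -- Without tasks the symbolic run is empty, so the stack of values is the represented term itself;
  -- `count` with no task and one value gives 4j + 1 + 1.
  reached-final : ∀ {s m V H} → Reached s m ⟪ [] , V , H ⟫ →
                  ∃[ g ] ∃[ t ] ∃[ j ] V ≡ g ∷ [] × g ≫[ H ] t × NormalForm s t j × m ≡ 4 * j + 2
  reached-final {m = m} (reached {j} d (_ , g ∷ [] , []) count) =
    _ , _ , _ , refl , g , (d , ≫-abstraction g) ,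
    trans (sym (+-identityʳ m)) (trans count (+-assoc (4 * j) 1 1))

  reached-normal : ∀ {s t j m V H} → Reached s m ⟪ [] , V , H ⟫ → NormalForm s t j → ∃[ g ] V ≡ g ∷ [] × g ≫[ H ] t
  reached-normal r (d , t-abs) with reached-final r
  ... | g , _ , _ , refl , g≫t′ , (d′ , t′-abs) , _ with normal-unique d t-abs d′ t′-abs
  ...   | refl , refl = g , refl , g≫t′

  -- Lexicographic induction on the number of reductions left and the number
  -- of commands left.
  reached-terminates : ∀ {s t m T V H} o c (r : Reached s m ⟪ T , V , H ⟫) →
                       term r ≻^[ o ] t → Abstraction t → commands T ≤ c →
                       ∃[ l ] ∃[ V′ ] ∃[ H′ ] m ≤ l × Reached s l ⟪ [] , V′ , H′ ⟫
  reached-terminates {T = []} o c r d at _ = _ , _ , _ , ≤-refl , r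
  reached-terminates {T = _ ∷ _} o c r d at T≤c with reached-step r
  reached-terminates {T = _ ∷ _} o (suc c) r d at T≤c | _ , _ , r′ , inj₁ (refl , less) =
    let l , _ , _ , m<l , r″ = reached-terminates o c r′ d at (≤-pred (≤-trans less T≤c)) in
    l , _ , _ , <⇒≤ m<l , r″
  reached-terminates {T = _ ∷ _} o c r done at T≤c | _ , _ , r′ , inj₂ q =
    contradiction q (abstraction-normal at)
  reached-terminates {T = _ ∷ _} (suc o) c r (step q′ d) at T≤c | _ , _ , r′ , inj₂ q with ≻-deterministic q′ q
  -- The bound on commands starts afresh, because a β-step queues the code of the body.
  ... | refl = let l , _ , _ , m<l , r″ = reached-terminates o _ r′ d at ≤-refl in l , _ , _ , <⇒≤ m<l , r″

  -- At least one more step is due, and the run from there on must end at step 4j + 2 exactly.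
  reached-unfinished : ∀ {s t j m h T V H} → NormalForm s t j → Reached s m ⟪ h ∷ T , V , H ⟫ → m < 4 * j + 2
  reached-unfinished {j = j} {m} (d , at) r with reached-step r
  ... | ⟪ _ , _ , _ ⟫ , _ , r′ , _ with ≻^-normal d at (reduces r′)
  ...   | o , _ , d′ with reached-terminates o _ r′ d′ at ≤-refl
  ...     | l , _ , _ , m<l , r″ with reached-final r″
  ...       | _ , _ , i , _ , _ , (e , au) , refl with normal-unique d at e au
  ...         | refl , _ = m<l

open HeapMachine

-- Moving words between stacks, with time bounds

module Transfers where

  private variable
    n t : ℕ
    p q : Prog n
    σ σ′ σ″ : Stacks n
    X Y Z : Fin n
    c : Symbol
    w : List Symbol

  isI not# any : Maybe Symbol → Bool
  isI (just I) = true
  isI _        = false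
  not# (just #) = false
  not# (just _) = true
  not# nothing  = false
  any (just _) = true
  any nothing  = false

  -- `isI`, `not#` and `any` are false on an empty stack, so the default is not met in the loops
  -- that they guard.
  copied : Fin n → Tops n → Symbol
  copied X cs = fromMaybe # (lookup cs X)

  mv : (Maybe Symbol → Bool) → Fin n → Fin n → Prog n
  mv b X Y = while (λ cs → b (lookup cs X)) (push Y (copied X) ⨟ pop X)

  mv₂ : (Maybe Symbol → Bool) → Fin n → Fin n → Fin n → Prog n
  mv₂ b X Y Z = while (λ cs → b (lookup cs X)) (push Y (copied X) ⨟ push Z (copied X) ⨟ pop X)

  clear : Fin n → Prog n
  clear X = while (λ cs → any (lookup cs X)) (pop X)

  ⇓-resp : σ′ ≡ σ″ → p ⊢ σ ⇓[ t ] σ′ → p ⊢ σ ⇓[ t ] σ″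
  ⇓-resp refl d = d

  ⇓-time : ∀ {u} → t ≡ u → p ⊢ σ ⇓[ t ] σ′ → p ⊢ σ ⇓[ u ] σ′
  ⇓-time refl d = d

  top : ∀ (σ : Stacks n) X → lookup σ X ≡ w → lookup (tops σ) X ≡ head w
  top σ X eq = trans (lookup-map X head σ) (cong head eq)

  push-copied : ∀ {σ : Stacks n} → lookup σ X ≡ c ∷ w → push Y (copied X) ⊢ σ ⇓[ 2 ] updateAt σ Y (c ∷_)
  push-copied {X = X} {c = c} {σ = σ} eq =
    ⇓-resp (cong (λ d → updateAt σ _ (fromMaybe # d ∷_)) (top σ X eq)) push

  lookup-popped : ∀ (σ : Stacks n) → lookup σ X ≡ c ∷ w → lookup (updateAt σ X (drop 1)) X ≡ w
  lookup-popped {X = X} σ eq = trans (lookup∘updateAt X σ) (cong (drop 1) eq)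

  lookup-other : ∀ {f} (σ : Stacks n) → X ≢ Y → lookup σ X ≡ w → lookup (updateAt σ Y f) X ≡ w
  lookup-other {X = X} {Y = Y} σ X≢Y eq = trans (lookup∘updateAt′ X Y X≢Y σ) eq

  module _ (b : Maybe Symbol → Bool) where

    Passes : List Symbol → Set
    Passes = All (λ c → b (just c) ≡ true)

    -- Popping from one stack and pushing onto another reverses the word, whence `ʳ++`; a word has
    -- to be moved twice to regain its order.
    mv-run : X ≢ Y → ∀ w {r} → lookup σ X ≡ w ++ r → Passes w → b (head r) ≡ false →
             mv b X Y ⊢ σ ⇓[ length w * 4 + 1 ] updateAt (updateAt σ X (const r)) Y (w ʳ++_)
    mv-run {X = X} {Y} {σ} X≢Y [] {r} eq [] stop =
      ⇓-resp (trans (sym (updateAt-id-local X σ (sym eq))) (sym (updateAt-id-local Y _ refl)))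
             (leave (trans (cong b (top σ X eq)) stop))
    mv-run {X = X} {Y} {σ} X≢Y (c ∷ w) {r} eq (ok ∷ oks) stop =
      ⇓-resp (begin
          updateAt (updateAt (updateAt (updateAt σ Y (c ∷_)) X (drop 1)) X (const r)) Y (w ʳ++_)
            ≡⟨ cong (λ τ → updateAt τ Y (w ʳ++_)) (updateAt-updateAt X _) ⟩
          updateAt (updateAt (updateAt σ Y (c ∷_)) X (const r)) Y (w ʳ++_)
            ≡⟨ cong (λ τ → updateAt τ Y (w ʳ++_)) (updateAt-commutes X Y X≢Y σ) ⟩
          updateAt (updateAt (updateAt σ X (const r)) Y (c ∷_)) Y (w ʳ++_)
            ≡⟨ updateAt-updateAt Y _ ⟩
          updateAt (updateAt σ X (const r)) Y ((c ∷ w) ʳ++_) ∎)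
        (again (trans (cong b (top σ X eq)) ok) (push-copied eq ⨟ pop)
          (mv-run X≢Y w (lookup-popped (updateAt σ Y _) (lookup-other σ X≢Y eq)) oks stop))
      where open ≡-Reasoning

    mv₂-run : X ≢ Y → X ≢ Z → Z ≢ Y → ∀ w {r} → lookup σ X ≡ w ++ r → Passes w → b (head r) ≡ false →
              mv₂ b X Y Z ⊢ σ ⇓[ length w * 6 + 1 ]
              updateAt (updateAt (updateAt σ X (const r)) Y (w ʳ++_)) Z (w ʳ++_)
    mv₂-run {X = X} {Y} {Z} {σ} X≢Y X≢Z Z≢Y [] {r} eq [] stop =
      ⇓-resp (trans (sym (updateAt-id-local X σ (sym eq)))
               (trans (sym (updateAt-id-local Y _ refl)) (sym (updateAt-id-local Z _ refl))))
             (leave (trans (cong b (top σ X eq)) stop))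
    mv₂-run {X = X} {Y} {Z} {σ} X≢Y X≢Z Z≢Y (c ∷ w) {r} eq (ok ∷ oks) stop =
      ⇓-resp (begin
          updateAt (updateAt (updateAt (updateAt (updateAt (updateAt σ Y (c ∷_)) Z (c ∷_)) X (drop 1)) X (const r)) Y (w ʳ++_)) Z (w ʳ++_)
            ≡⟨ cong finish (updateAt-updateAt X _) ⟩
          updateAt (updateAt (updateAt (updateAt (updateAt σ Y (c ∷_)) Z (c ∷_)) X (const r)) Y (w ʳ++_)) Z (w ʳ++_)
            ≡⟨ cong finish (updateAt-commutes X Z X≢Z _) ⟩
          updateAt (updateAt (updateAt (updateAt (updateAt σ Y (c ∷_)) X (const r)) Z (c ∷_)) Y (w ʳ++_)) Z (w ʳ++_)
            ≡⟨ cong (λ τ → finish (updateAt τ Z (c ∷_))) (updateAt-commutes X Y X≢Y σ) ⟩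
          updateAt (updateAt (updateAt (updateAt (updateAt σ X (const r)) Y (c ∷_)) Z (c ∷_)) Y (w ʳ++_)) Z (w ʳ++_)
            ≡⟨ cong (λ τ → updateAt τ Z (w ʳ++_)) (sym (updateAt-commutes Z Y Z≢Y _)) ⟩
          updateAt (updateAt (updateAt (updateAt (updateAt σ X (const r)) Y (c ∷_)) Y (w ʳ++_)) Z (c ∷_)) Z (w ʳ++_)
            ≡⟨ updateAt-updateAt Z _ ⟩
          updateAt (updateAt (updateAt (updateAt σ X (const r)) Y (c ∷_)) Y (w ʳ++_)) Z ((c ∷ w) ʳ++_)
            ≡⟨ cong (λ τ → updateAt τ Z ((c ∷ w) ʳ++_)) (updateAt-updateAt Y _) ⟩
          updateAt (updateAt (updateAt σ X (const r)) Y ((c ∷ w) ʳ++_)) Z ((c ∷ w) ʳ++_) ∎)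
        (again (trans (cong b (top σ X eq)) ok)
          (push-copied eq ⨟ push-copied eqY ⨟ pop)
          (mv₂-run X≢Y X≢Z Z≢Y w (lookup-popped (updateAt (updateAt σ Y _) Z _) (lookup-other (updateAt σ Y _) X≢Z eqY)) oks stop))
      where
      open ≡-Reasoning
      eqY = lookup-other σ X≢Y eq
      finish : Stacks _ → Stacks _
      finish τ = updateAt (updateAt τ Y (w ʳ++_)) Z (w ʳ++_)

  clear-run : ∀ w → lookup σ X ≡ w → clear X ⊢ σ ⇓[ length w * 2 + 1 ] updateAt σ X (const [])
  clear-run {σ = σ} {X = X} [] eq =
    ⇓-resp (sym (updateAt-id-local X σ (sym eq))) (leave (cong any (top σ X eq)))
  clear-run {σ = σ} {X = X} (c ∷ w) eq =
    ⇓-resp (updateAt-updateAt X σ)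
      (again (cong any (top σ X eq)) pop (clear-run w (lookup-popped σ eq)))

  -- Unary numbers are palindromes, so addresses survive a single move.
  unary-ʳ++ : ∀ a (v : List Symbol) → unary a ʳ++ v ≡ unary a ++ v
  unary-ʳ++ zero    v = refl
  unary-ʳ++ (suc a) v = trans (unary-ʳ++ a (I ∷ v)) (shift a)
    where
    shift : ∀ a → unary a ++ I ∷ v ≡ I ∷ unary a ++ v
    shift zero    = refl
    shift (suc a) = cong (I ∷_) (shift a)

  All-ʳ++ : ∀ {Q : Symbol → Set} {v} → All Q w → All Q v → All Q (w ʳ++ v)
  All-ʳ++ []       vs = vs
  All-ʳ++ (x ∷ xs) vs = All-ʳ++ xs (x ∷ vs)

  any-passes : ∀ w → Passes any w
  any-passes []      = []
  any-passes (_ ∷ w) = refl ∷ any-passes w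

  unary-passes : ∀ {b} a → b (just I) ≡ true → Passes b (unary a)
  unary-passes a ok = replicate⁺ a ok

  -- Encoded programs are free of `#`, which can therefore serve as their end marker.
  code-passes : ∀ P → Passes not# (encProgram P)
  code-passes []          = []
  code-passes (ret ∷ P)   = refl ∷ code-passes P
  code-passes (var n ∷ P) = refl ∷ ++⁺ (unary-passes {not#} n refl) (code-passes P)
  code-passes (lam ∷ P)   = refl ∷ code-passes P
  code-passes (app ∷ P)   = refl ∷ code-passes P

  seg : Fin n → Fin n → Prog n
  seg X Y = mv not# X Y ⨟ push Y (const #) ⨟ pop X

  seg₂ : Fin n → Fin n → Fin n → Prog n
  seg₂ X Y Z = mv₂ not# X Y Z ⨟ push Y (const #) ⨟ push Z (const #) ⨟ pop X

  module Bounded (U : ℕ) (1≤U : 1 ≤ U) where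

    private variable
      a d : ℕ
      b : Tops n → Bool

    infix 4 _⊢_↓[_]_

    -- Time in units of U, which bounds the length of every word moved by one loop.
    record _⊢_↓[_]_ (p : Prog n) (σ : Stacks n) (a : ℕ) (σ′ : Stacks n) : Set where
      constructor ⌊_⌋
      field
        ⇓ : p ⊢ σ ⇓[ a * U ] σ′

    open _⊢_↓[_]_ public

    scale : ∀ a → a ≤ a * U
    scale a = ≤-trans (≤-reflexive (sym (*-identityʳ a))) (*-monoʳ-≤ a 1≤U)

    pop↓ : ∀ {i} → pop i ⊢ σ ↓[ 1 ] updateAt σ i (drop 1)
    pop↓ = ⌊ weaken (scale 1) pop ⌋

    push↓ : ∀ {i f} → push i f ⊢ σ ↓[ 2 ] updateAt σ i (f (tops σ) ∷_)
    push↓ = ⌊ weaken (scale 2) push ⌋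

    infixr 5 _⨾_

    _⨾_ : p ⊢ σ ↓[ a ] σ′ → q ⊢ σ′ ↓[ d ] σ″ → p ⨟ q ⊢ σ ↓[ a + d ] σ″
    _⨾_ {a = a} {d = d} ⌊ x ⌋ ⌊ y ⌋ = ⌊ ⇓-time (sym (*-distribʳ-+ U a d)) (x ⨟ y) ⌋

    then↓ : b (tops σ) ≡ true → p ⊢ σ ↓[ a ] σ′ → branch b p q ⊢ σ ↓[ 1 + a ] σ′
    then↓ {a = a} eq ⌊ x ⌋ = ⌊ weaken (+-monoˡ-≤ (a * U) 1≤U) (thenᵇ eq x) ⌋

    else↓ : b (tops σ) ≡ false → q ⊢ σ ↓[ a ] σ′ → branch b p q ⊢ σ ↓[ 1 + a ] σ′
    else↓ {a = a} eq ⌊ x ⌋ = ⌊ weaken (+-monoˡ-≤ (a * U) 1≤U) (elseᵇ eq x) ⌋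

    again↓ : b (tops σ) ≡ true → p ⊢ σ ↓[ a ] σ′ → while b p ⊢ σ′ ↓[ d ] σ″ → while b p ⊢ σ ↓[ 1 + a + d ] σ″
    again↓ {a = a} {d = d} eq ⌊ x ⌋ ⌊ y ⌋ =
      ⌊ weaken (≤-trans (+-monoˡ-≤ (d * U) (+-monoˡ-≤ (a * U) 1≤U))
                        (≤-reflexive (sym (*-distribʳ-+ U (1 + a) d)))) (again eq x y) ⌋

    leave↓ : b (tops σ) ≡ false → while b p ⊢ σ ↓[ 1 ] σ
    leave↓ eq = ⌊ weaken (scale 1) (leave eq) ⌋

    weaken↓ : a ≤ d → p ⊢ σ ↓[ a ] σ′ → p ⊢ σ ↓[ d ] σ′
    weaken↓ a≤d ⌊ x ⌋ = ⌊ weaken (*-monoˡ-≤ U a≤d) x ⌋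

    resp↓ : σ′ ≡ σ″ → p ⊢ σ ↓[ a ] σ′ → p ⊢ σ ↓[ a ] σ″
    resp↓ refl d = d

    -- The last, failing test of a loop is paid for by one further unit.
    linear : ∀ {l} a → l ≤ U → l * a + 1 ≤ (1 + a) * U
    linear {l} a l≤U = begin
      l * a + 1  ≤⟨ +-mono-≤ (*-monoˡ-≤ a l≤U) 1≤U ⟩
      U * a + U  ≡⟨ solve 2 (λ U a → U :* a :+ U := (con 1 :+ a) :* U) refl U a ⟩
      (1 + a) * U ∎
      where
      open ≤-Reasoning
      open +-*-Solver

    mv↓ : ∀ b → X ≢ Y → ∀ w {r} → lookup σ X ≡ w ++ r → Passes b w → b (head r) ≡ false → length w ≤ U →
          mv b X Y ⊢ σ ↓[ 5 ] updateAt (updateAt σ X (const r)) Y (w ʳ++_)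
    mv↓ b X≢Y w eq oks stop w≤U = ⌊ weaken (linear 4 w≤U) (mv-run b X≢Y w eq oks stop) ⌋

    mv₂↓ : ∀ b → X ≢ Y → X ≢ Z → Z ≢ Y → ∀ w {r} → lookup σ X ≡ w ++ r → Passes b w → b (head r) ≡ false →
           length w ≤ U →
           mv₂ b X Y Z ⊢ σ ↓[ 7 ] updateAt (updateAt (updateAt σ X (const r)) Y (w ʳ++_)) Z (w ʳ++_)
    mv₂↓ b X≢Y X≢Z Z≢Y w eq oks stop w≤U = ⌊ weaken (linear 6 w≤U) (mv₂-run b X≢Y X≢Z Z≢Y w eq oks stop) ⌋

    clear↓ : ∀ w → lookup σ X ≡ w → length w ≤ U → clear X ⊢ σ ↓[ 3 ] updateAt σ X (const [])
    clear↓ w eq w≤U = ⌊ weaken (linear 2 w≤U) (clear-run w eq) ⌋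

    mvᵘ↓ : ∀ b → X ≢ Y → ∀ a {r} → lookup σ X ≡ unary a ++ r → b (just I) ≡ true → b (head r) ≡ false → a ≤ U →
           mv b X Y ⊢ σ ↓[ 5 ] updateAt (updateAt σ X (const r)) Y (unary a ++_)
    mvᵘ↓ b X≢Y a eq ok stop a≤U =
      resp↓ (updateAt-cong _ (unary-ʳ++ a) _)
        (mv↓ b X≢Y (unary a) eq (unary-passes {b} a ok) stop (≤-trans (≤-reflexive (length-replicate a)) a≤U))

    mvᵘ₀↓ : ∀ b → X ≢ Y → ∀ a {r} → lookup σ X ≡ unary a ++ r → lookup σ Y ≡ [] → b (just I) ≡ true →
            b (head r) ≡ false → a ≤ U →
            mv b X Y ⊢ σ ↓[ 5 ] updateAt (updateAt σ X (const r)) Y (const (unary a))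
    mvᵘ₀↓ {X = X} {Y} {σ} b X≢Y a eq empty ok stop a≤U =
      resp↓ (updateAt-cong-local Y _ (trans (cong (unary a ++_) (lookup-other σ (X≢Y ∘ sym) empty)) (++-identityʳ _)))
        (mvᵘ↓ b X≢Y a eq ok stop a≤U)

    mvᵘ₂↓ : ∀ b → X ≢ Y → X ≢ Z → Z ≢ Y → ∀ a {r} → lookup σ X ≡ unary a ++ r →
            b (just I) ≡ true → b (head r) ≡ false → a ≤ U →
            mv₂ b X Y Z ⊢ σ ↓[ 7 ] updateAt (updateAt (updateAt σ X (const r)) Y (unary a ++_)) Z (unary a ++_)
    mvᵘ₂↓ b X≢Y X≢Z Z≢Y a eq ok stop a≤U =
      resp↓ (trans (updateAt-cong _ (unary-ʳ++ a) _) (cong (λ τ → updateAt τ _ _) (updateAt-cong _ (unary-ʳ++ a) _)))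
        (mv₂↓ b X≢Y X≢Z Z≢Y (unary a) eq (unary-passes {b} a ok) stop (≤-trans (≤-reflexive (length-replicate a)) a≤U))

    mvAll↓ : ∀ b → X ≢ Y → ∀ w → lookup σ X ≡ w → Passes b w → b nothing ≡ false → length w ≤ U →
             mv b X Y ⊢ σ ↓[ 5 ] updateAt (updateAt σ X (const [])) Y (w ʳ++_)
    mvAll↓ b X≢Y w eq oks stop w≤U = mv↓ b X≢Y w (trans eq (sym (++-identityʳ w))) oks stop w≤U

    mvBack↓ : ∀ b → X ≢ Y → ∀ w → lookup σ X ≡ w ʳ++ [] → Passes b w → b nothing ≡ false → length w ≤ U →
              mv b X Y ⊢ σ ↓[ 5 ] updateAt (updateAt σ X (const [])) Y (w ++_)
    mvBack↓ b X≢Y w eq oks stop w≤U =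
      resp↓ (updateAt-cong _ (λ _ → ʳ++-ʳ++ w) _)
        (mvAll↓ b X≢Y (w ʳ++ []) eq (All-ʳ++ oks []) stop
          (≤-trans (≤-reflexive (trans (length-ʳ++ w) (+-identityʳ _))) w≤U))

    seg↓ : X ≢ Y → ∀ w {r} → lookup σ X ≡ w ++ # ∷ r → Passes not# w → length w ≤ U →
           seg X Y ⊢ σ ↓[ 8 ] updateAt (updateAt σ X (const r)) Y (λ v → # ∷ w ʳ++ v)
    seg↓ {X = X} {Y} {σ} X≢Y w eq oks w≤U =
      resp↓ (trans (cong (λ τ → updateAt τ X (drop 1)) (updateAt-updateAt Y (updateAt σ X _)))
            (trans (updateAt-commutes X Y X≢Y (updateAt σ X _)) (cong (λ τ → updateAt τ Y _) (updateAt-updateAt X σ))))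
        (mv↓ not# X≢Y w eq oks refl w≤U ⨾ push↓ ⨾ pop↓)

    seg₂↓ : X ≢ Y → X ≢ Z → Z ≢ Y → ∀ w {r} → lookup σ X ≡ w ++ # ∷ r → Passes not# w → length w ≤ U →
            seg₂ X Y Z ⊢ σ ↓[ 12 ]
            updateAt (updateAt (updateAt σ X (const r)) Y (λ v → # ∷ w ʳ++ v)) Z (λ v → # ∷ w ʳ++ v)
    seg₂↓ {X = X} {Y} {Z} {σ} X≢Y X≢Z Z≢Y w {r} eq oks w≤U =
      resp↓ (begin
          updateAt (updateAt (updateAt (updateAt (updateAt (updateAt σ X (const (# ∷ r))) Y _) Z _) Y (# ∷_)) Z (# ∷_)) X (drop 1)
            ≡⟨ cong (λ τ → updateAt (updateAt τ Z (# ∷_)) X (drop 1)) (sym (updateAt-commutes Z Y Z≢Y _)) ⟩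
          updateAt (updateAt (updateAt (updateAt (updateAt (updateAt σ X (const (# ∷ r))) Y _) Y (# ∷_)) Z _) Z (# ∷_)) X (drop 1)
            ≡⟨ cong (λ τ → updateAt τ X (drop 1)) (updateAt-updateAt Z _) ⟩
          updateAt (updateAt (updateAt (updateAt (updateAt σ X (const (# ∷ r))) Y _) Y (# ∷_)) Z _) X (drop 1)
            ≡⟨ cong (λ τ → updateAt (updateAt τ Z _) X (drop 1)) (updateAt-updateAt Y _) ⟩
          updateAt (updateAt (updateAt (updateAt σ X (const (# ∷ r))) Y _) Z _) X (drop 1)
            ≡⟨ updateAt-commutes X Z X≢Z _ ⟩
          updateAt (updateAt (updateAt (updateAt σ X (const (# ∷ r))) Y _) X (drop 1)) Z _
            ≡⟨ cong (λ τ → updateAt τ Z _) (updateAt-commutes X Y X≢Y _) ⟩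
          updateAt (updateAt (updateAt (updateAt σ X (const (# ∷ r))) X (drop 1)) Y _) Z _
            ≡⟨ cong (λ τ → updateAt (updateAt τ Y _) Z _) (updateAt-updateAt X σ) ⟩
          updateAt (updateAt (updateAt σ X (const r)) Y _) Z _ ∎)
        (mv₂↓ not# X≢Y X≢Z Z≢Y w eq oks refl w≤U ⨾ push↓ ⨾ push↓ ⨾ pop↓)
      where open ≡-Reasoning

open Transfers

-- The interpreter and its tape layout

module Interpreter where

  private variable
    σ : Stacks 10
    t : ℕ

  -- walkₜ receives the heap when it is traversed, heapₜ stores it in reverse;
  -- countₜ holds an index or a nesting depth, lastₜ the length of the heap.
  fuelₜ tasksₜ walkₜ valuesₜ heapₜ addrₜ gotoₜ countₜ lastₜ tempₜ : Fin 10
  fuelₜ   = 0F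
  tasksₜ  = 1F
  walkₜ   = 2F
  valuesₜ = 3F
  heapₜ   = 4F
  addrₜ   = 5F
  gotoₜ   = 6F
  countₜ  = 7F
  lastₜ   = 8F
  tempₜ   = 9F

  isLAM isVAR isRET : Maybe Symbol → Bool
  isLAM (just LAM) = true
  isLAM _          = false
  isVAR (just VAR) = true
  isVAR _          = false
  isRET (just RET) = true
  isRET _          = false

  tasks-to-temp : Prog 10
  tasks-to-temp = push tempₜ (copied tasksₜ) ⨟ pop tasksₜ

  -- A `RET` ends the body only if no inner `LAM` is still open, that is, if `countₜ` is empty.
  inBody : Tops 10 → Bool
  inBody cs = if isRET (lookup cs tasksₜ) then any (lookup cs countₜ) else true

  extract : Prog 10
  extract = while inBody
    (branch (λ cs → isLAM (lookup cs tasksₜ)) (push countₜ (const I) ⨟ tasks-to-temp)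
    (branch (λ cs → isRET (lookup cs tasksₜ)) (pop countₜ ⨟ tasks-to-temp) tasks-to-temp))

  skip : Prog 10
  skip = while (λ cs → any (lookup cs gotoₜ))
    (pop gotoₜ ⨟ seg walkₜ heapₜ ⨟ seg walkₜ heapₜ ⨟ seg walkₜ heapₜ)

  goto : Prog 10
  -- Rewinding first allows a jump from any position. One digit is dropped because addresses count
  -- from 1.
  goto = mv any heapₜ walkₜ ⨟ pop gotoₜ ⨟ skip

  -- The pointer to the next environment is copied, while its end marker stays behind on `walkₜ`;
  -- the rewinding in `goto` joins the two again.
  chase : Prog 10
  chase = while (λ cs → any (lookup cs countₜ))
    (pop countₜ ⨟ seg walkₜ heapₜ ⨟ seg walkₜ heapₜ ⨟ mv₂ not# walkₜ heapₜ gotoₜ ⨟ goto)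

  doNil doLam doVar doApp exec : Prog 10
  doNil = pop tasksₜ ⨟ clear addrₜ
  doLam = pop tasksₜ ⨟ extract ⨟ pop tasksₜ ⨟ push valuesₜ (const #) ⨟ push tasksₜ (const #) ⨟
    mv₂ not# addrₜ valuesₜ tasksₜ ⨟ push valuesₜ (const #) ⨟ mv not# tempₜ valuesₜ
  doVar = pop tasksₜ ⨟ mv isI tasksₜ countₜ ⨟ push tasksₜ (const #) ⨟ mv₂ not# addrₜ tasksₜ gotoₜ ⨟
    goto ⨟ chase ⨟ seg₂ walkₜ heapₜ tempₜ ⨟ seg₂ walkₜ heapₜ tempₜ ⨟ mv any tempₜ valuesₜ ⨟ mv any walkₜ heapₜ
  -- The argument and the environment of the function go straight to the end of the heap, while the
  -- code of the function is diverted to `tempₜ` for the new task.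
  doApp = pop tasksₜ ⨟ push tasksₜ (const #) ⨟ mv not# addrₜ tasksₜ ⨟
    seg valuesₜ heapₜ ⨟ seg valuesₜ heapₜ ⨟ mv not# valuesₜ tempₜ ⨟ pop valuesₜ ⨟ seg valuesₜ heapₜ ⨟
    push tasksₜ (const #) ⨟ mv not# tempₜ tasksₜ ⨟ push tasksₜ (const #) ⨟ push lastₜ (const I) ⨟
    mv₂ not# lastₜ tasksₜ tempₜ ⨟ mv not# tempₜ lastₜ
  exec = mv not# tasksₜ addrₜ ⨟ pop tasksₜ ⨟
    branch (λ cs → not# (lookup cs tasksₜ))
      (branch (λ cs → isLAM (lookup cs tasksₜ)) doLam
      (branch (λ cs → isVAR (lookup cs tasksₜ)) doVar doApp))
      doNil

  -- A task begins with its address: once that is moved to `addrₜ`, the next command is on top. A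
  -- value is laid out as in `encClosure`, so the last remaining one is already the output.
  tasksᵉ valuesᵉ : List Closure → List Symbol
  tasksᵉ []            = []
  tasksᵉ ((P , a) ∷ T) = unary a ++ # ∷ encProgram P ++ # ∷ tasksᵉ T
  valuesᵉ []            = []
  valuesᵉ ((P , a) ∷ V) = encProgram P ++ # ∷ unary a ++ # ∷ valuesᵉ V

  -- In the reversed form a new last entry is pushed on top. The accumulator `r` makes one traversal
  -- step hold by computation.
  heapᵉ heapᴿ : Heap → List Symbol → List Symbol
  heapᵉ []                  r = r
  heapᵉ (((P , a) , b) ∷ H) r = encProgram P ++ # ∷ unary a ++ # ∷ unary b ++ # ∷ heapᵉ H r
  heapᴿ []                  r = r
  heapᴿ (((P , a) , b) ∷ H) r = heapᴿ H (# ∷ unary b ʳ++ # ∷ unary a ʳ++ # ∷ encProgram P ʳ++ r)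

  state : ℕ → HeapState → Stacks 10
  state k ⟪ T , V , H ⟫ =
    unary k ∷ tasksᵉ T ∷ [] ∷ valuesᵉ V ∷ heapᴿ H [] ∷ [] ∷ [] ∷ [] ∷ unary (length H) ∷ [] ∷ []

  heapᵉ-++ : ∀ H {H′ r} → heapᵉ (H ++ H′) r ≡ heapᵉ H (heapᵉ H′ r)
  heapᵉ-++ []                  = refl
  heapᵉ-++ (((P , a) , b) ∷ H) =
    cong (λ x → encProgram P ++ # ∷ unary a ++ # ∷ unary b ++ # ∷ x) (heapᵉ-++ H)

  heapᴿ-++ : ∀ H {H′ r} → heapᴿ (H ++ H′) r ≡ heapᴿ H′ (heapᴿ H r)
  heapᴿ-++ []      = refl
  heapᴿ-++ (_ ∷ H) = heapᴿ-++ H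

  heapᵉ-ʳ++ : ∀ H {w r} → heapᵉ H w ʳ++ r ≡ w ʳ++ heapᴿ H r
  heapᵉ-ʳ++ []                  = refl
  heapᵉ-ʳ++ (((P , a) , b) ∷ H) =
    trans (++-ʳ++ (encProgram P)) (trans (++-ʳ++ (unary a)) (trans (++-ʳ++ (unary b)) (heapᵉ-ʳ++ H)))

  heapᴿ-ʳ++ : ∀ H {w r} → heapᴿ H r ʳ++ w ≡ r ʳ++ heapᵉ H w
  heapᴿ-ʳ++ []                  = refl
  heapᴿ-ʳ++ (((P , a) , b) ∷ H) =
    trans (heapᴿ-ʳ++ H) (trans (ʳ++-ʳ++ (unary b)) (trans (ʳ++-ʳ++ (unary a)) (ʳ++-ʳ++ (encProgram P))))

  -- `encTerm s` with a continuation, by recursion on the term instead of on its commands, so that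
  -- `extract` can be followed by induction on the body.
  code : Term → List Symbol → List Symbol
  code (` n)   r = VAR ∷ unary n ++ r
  code (s · t) r = code s (code t (APP ∷ r))
  code (ƛ s)   r = LAM ∷ code s (RET ∷ r)

  codeᴿ : Term → List Symbol → List Symbol
  codeᴿ (` n)   w = unary n ʳ++ VAR ∷ w
  codeᴿ (s · t) w = APP ∷ codeᴿ t (codeᴿ s w)
  codeᴿ (ƛ s)   w = RET ∷ codeᴿ s (LAM ∷ w)

  encProgram-++ : ∀ P Q → encProgram (P ++ Q) ≡ encProgram P ++ encProgram Q
  encProgram-++ P Q = concatMap-++ encCommand P Q

  encTerm-· : ∀ s t → encTerm (s · t) ≡ encTerm s ++ encTerm t ++ APP ∷ []
  encTerm-· s t = trans (encProgram-++ (γ s) _) (cong (encTerm s ++_) (encProgram-++ (γ t) _))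

  encTerm-ƛ : ∀ s → encTerm (ƛ s) ≡ LAM ∷ encTerm s ++ RET ∷ []
  encTerm-ƛ s = cong (LAM ∷_) (encProgram-++ (γ s) _)

  encTerm-code : ∀ s {r} → encTerm s ++ r ≡ code s r
  encTerm-code (` n) {r} = cong (λ v → VAR ∷ v ++ r) (++-identityʳ (unary n))
  encTerm-code (s · t) {r} = begin
    encTerm (s · t) ++ r                         ≡⟨ cong (_++ r) (encTerm-· s t) ⟩
    (encTerm s ++ encTerm t ++ APP ∷ []) ++ r     ≡⟨ ++-assoc (encTerm s) _ r ⟩
    encTerm s ++ (encTerm t ++ APP ∷ []) ++ r     ≡⟨ cong (encTerm s ++_) (++-assoc (encTerm t) _ r) ⟩
    encTerm s ++ encTerm t ++ APP ∷ r             ≡⟨ encTerm-code s ⟩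
    code s (encTerm t ++ APP ∷ r)                 ≡⟨ cong (code s) (encTerm-code t) ⟩
    code s (code t (APP ∷ r))                     ∎
    where open ≡-Reasoning
  encTerm-code (ƛ s) {r} = begin
    encTerm (ƛ s) ++ r                 ≡⟨ cong (_++ r) (encTerm-ƛ s) ⟩
    LAM ∷ (encTerm s ++ RET ∷ []) ++ r ≡⟨ cong (LAM ∷_) (++-assoc (encTerm s) _ r) ⟩
    LAM ∷ encTerm s ++ RET ∷ r         ≡⟨ cong (LAM ∷_) (encTerm-code s) ⟩
    LAM ∷ code s (RET ∷ r)             ∎
    where open ≡-Reasoning

  encTerm-codeᴿ : ∀ s {w} → encTerm s ʳ++ w ≡ codeᴿ s w
  encTerm-codeᴿ (` n) {w} = cong (_ʳ++ (VAR ∷ w)) (++-identityʳ (unary n))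
  encTerm-codeᴿ (s · t) {w} = begin
    encTerm (s · t) ʳ++ w                       ≡⟨ cong (_ʳ++ w) (encTerm-· s t) ⟩
    (encTerm s ++ encTerm t ++ APP ∷ []) ʳ++ w  ≡⟨ ++-ʳ++ (encTerm s) ⟩
    (encTerm t ++ APP ∷ []) ʳ++ encTerm s ʳ++ w ≡⟨ ++-ʳ++ (encTerm t) ⟩
    APP ∷ encTerm t ʳ++ encTerm s ʳ++ w         ≡⟨ cong (λ v → APP ∷ encTerm t ʳ++ v) (encTerm-codeᴿ s) ⟩
    APP ∷ encTerm t ʳ++ codeᴿ s w               ≡⟨ cong (APP ∷_) (encTerm-codeᴿ t) ⟩
    codeᴿ (s · t) w                             ∎
    where open ≡-Reasoning
  encTerm-codeᴿ (ƛ s) {w} = begin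
    encTerm (ƛ s) ʳ++ w                    ≡⟨ cong (_ʳ++ w) (encTerm-ƛ s) ⟩
    (encTerm s ++ RET ∷ []) ʳ++ LAM ∷ w    ≡⟨ ++-ʳ++ (encTerm s) ⟩
    RET ∷ encTerm s ʳ++ LAM ∷ w            ≡⟨ cong (RET ∷_) (encTerm-codeᴿ s) ⟩
    codeᴿ (ƛ s) w                          ∎
    where open ≡-Reasoning

  length-encTerm-· : ∀ s t → length (encTerm (s · t)) ≡ length (encTerm s) + (length (encTerm t) + 1)
  length-encTerm-· s t = trans (cong length (encTerm-· s t))
    (trans (length-++ (encTerm s)) (cong (length (encTerm s) +_) (length-++ (encTerm t))))

  length-encTerm-ƛ : ∀ s → length (encTerm (ƛ s)) ≡ suc (length (encTerm s) + 1)
  length-encTerm-ƛ s = trans (cong length (encTerm-ƛ s)) (cong suc (length-++ (encTerm s)))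

  module _ (K O V R A B C : List Symbol) where

    private
      extracting : List Symbol → List Symbol → List Symbol → Stacks 10
      extracting r w d = K ∷ r ∷ O ∷ V ∷ R ∷ A ∷ B ∷ d ∷ C ∷ w ∷ []

      extract-I : ∀ n {r w d} → extract ⊢ extracting r (unary n ʳ++ w) d ⇓[ t ] σ →
                  extract ⊢ extracting (unary n ++ r) w d ⇓[ n * 7 + t ] σ
      extract-I zero    e = e
      -- Passing over such a symbol takes 6 steps; the rate of 7 is set by `LAM` and `RET`, which
      -- also change the depth.
      extract-I (suc n) e = weaken (+-monoˡ-≤ _ (n≤1+n 6)) (again refl (elseᵇ refl (elseᵇ refl (push ⨟ pop))) (extract-I n e))

      -- The count of open abstractions returns to its value, so RET is passed over.
      extract-code : ∀ u {r w d} → extract ⊢ extracting r (codeᴿ u w) d ⇓[ t ] σ →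
                     extract ⊢ extracting (code u r) w d ⇓[ length (encTerm u) * 7 + t ] σ
      extract-code {t = t} (` n) e =
        weaken (≤-reflexive (cong (λ l → 7 + (l * 7 + t))
          (sym (trans (cong length (++-identityʳ (unary n))) (length-replicate n)))))
          (weaken (n≤1+n _) (again refl (elseᵇ refl (elseᵇ refl (push ⨟ pop))) (extract-I n e)))
      extract-code {t = t} (s · v) e =
        ⇓-time (trans (solve 3 (λ m n t → m :* con 7 :+ (n :* con 7 :+ (con 7 :+ t)) := (m :+ (n :+ con 1)) :* con 7 :+ t)
                  refl (length (encTerm s)) (length (encTerm v)) t)
                (cong (λ l → l * 7 + t) (sym (length-encTerm-· s v))))
          (extract-code s (extract-code v
            (weaken (n≤1+n _) (again refl (elseᵇ refl (elseᵇ refl (push ⨟ pop))) e))))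
        where open +-*-Solver
      extract-code {t = t} (ƛ s) e =
        ⇓-time (trans (solve 2 (λ m t → con 7 :+ (m :* con 7 :+ (con 7 :+ t)) := (con 1 :+ (m :+ con 1)) :* con 7 :+ t)
                  refl (length (encTerm s)) t)
                (cong (λ l → l * 7 + t) (sym (length-encTerm-ƛ s))))
          (again refl (thenᵇ refl (push ⨟ push ⨟ pop)) (extract-code s
            (again refl (elseᵇ refl (thenᵇ refl (pop ⨟ push ⨟ pop))) e)))
        where open +-*-Solver

    extract-run : ∀ u r → extract ⊢ K ∷ code u (RET ∷ r) ∷ O ∷ V ∷ R ∷ A ∷ B ∷ [] ∷ C ∷ [] ∷ []
                  ⇓[ length (encTerm u) * 7 + 1 ] K ∷ (RET ∷ r) ∷ O ∷ V ∷ R ∷ A ∷ B ∷ [] ∷ C ∷ codeᴿ u [] ∷ []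
    extract-run u r = extract-code u (leave refl)

open Interpreter

-- Walking through the stored heap

module HeapTraversal where

  entry-split : ∀ H a {e} → H [ a ] ≡ just e → ∃[ H₁ ] ∃[ H₃ ] H ≡ H₁ ++ e ∷ H₃ × a ≡ suc (length H₁)
  entry-split (e ∷ H) (suc zero)    refl = [] , H , refl , refl
  entry-split (e ∷ H) (suc (suc a)) eq   with entry-split H (suc a) eq
  ... | H₁ , H₃ , refl , refl = e ∷ H₁ , H₃ , refl , refl

  -- The index of a variable has no end marker of its own; it ends because neither a command nor `#`
  -- begins with `I`.
  isI-code : ∀ P {r} → isI (head (encProgram P ++ # ∷ r)) ≡ false
  isI-code []          = refl
  isI-code (ret ∷ P)   = refl
  isI-code (var n ∷ P) = refl
  isI-code (lam ∷ P)   = refl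
  isI-code (app ∷ P)   = refl

  module Simulation (U : ℕ) (1≤U : 1 ≤ U) where

    open Bounded U 1≤U

    -- The two extra cells are the markers: a lookup moves a whole encoded closure in one loop.
    FitsC : Closure → Set
    FitsC (P , a) = length (encProgram P) + suc (suc a) ≤ U

    FitsE : Entry → Set
    FitsE (g , b) = FitsC g × b ≤ U

    code≤U : ∀ P {a} → FitsC (P , a) → length (encProgram P) ≤ U
    code≤U P = ≤-trans (m≤m+n _ _)

    addr≤U : ∀ P {a} → FitsC (P , a) → a ≤ U
    addr≤U P {a} fits = ≤-trans (≤-trans (n≤1+n a) (n≤1+n (suc a))) (≤-trans (m≤n+m _ (length (encProgram P))) fits)

    unary≤U : ∀ {a} → a ≤ U → length (unary a) ≤ U
    unary≤U {a} = ≤-trans (≤-reflexive (length-replicate a))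

    module Walk (K T V C W : List Symbol) where

      walk : List Symbol → List Symbol → List Symbol → List Symbol → Stacks 10
      walk o r b n = K ∷ T ∷ o ∷ V ∷ r ∷ [] ∷ b ∷ n ∷ C ∷ W ∷ []

      -- An entry costs one test, one pop and three fields of 8 units each.
      skip↓ : ∀ H {o r n} → All FitsE H → skip ⊢ walk (heapᵉ H o) r (unary (length H)) n ↓[ length H * 26 + 1 ] walk o (heapᴿ H r) [] n
      skip↓ []                  []                    = leave↓ refl
      skip↓ (((P , a) , b) ∷ H) ((fits , b≤U) ∷ fitss) =
        again↓ refl
          (pop↓ ⨾ seg↓ (λ ()) (encProgram P) refl (code-passes P) (code≤U P fits)
                ⨾ seg↓ (λ ()) (unary a) refl (unary-passes {not#} a refl) (unary≤U (addr≤U P fits))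
                ⨾ seg↓ (λ ()) (unary b) refl (unary-passes {not#} b refl) (unary≤U b≤U))
          (skip↓ H fitss)

      -- `r ʳ++ o` reads the two stacks as one tape split at an arbitrary point, so the jump may
      -- start anywhere in the heap.
      goto↓ : ∀ H₁ e H₃ {o r b n} → r ʳ++ o ≡ heapᵉ (H₁ ++ e ∷ H₃) [] →
              length (heapᵉ (H₁ ++ e ∷ H₃) []) ≤ U → All FitsE H₁ → b ≡ unary (suc (length H₁)) →
              goto ⊢ walk o r b n ↓[ length H₁ * 26 + 7 ] walk (heapᵉ (e ∷ H₃) []) (heapᴿ H₁ []) [] n
      goto↓ H₁ e H₃ {o} {r} {n = n} eq size fits refl =
        weaken↓ (≤-reflexive (solve 1 (λ h → con 5 :+ (con 1 :+ (h :+ con 1)) := h :+ con 7) refl (length H₁ * 26)))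
          (resp↓ (cong (λ x → walk x [] _ n) (trans eq (heapᵉ-++ H₁))) (mvAll↓ any (λ ()) r refl (any-passes r) refl r≤U)
           ⨾ pop↓ ⨾ skip↓ H₁ fits)
        where
        open +-*-Solver
        r≤U : length r ≤ U
        r≤U = ≤-trans (m≤m+n (length r) (length o))
                (≤-trans (≤-reflexive (trans (sym (length-ʳ++ r)) (cong length eq))) size)

      module _ (H : Heap) (size : length (heapᵉ H []) ≤ U) (fits : All FitsE H) where

        record Stop (g : Closure) : Set where
          field
            before   : Heap
            next-env : Address
            after    : Heap
            split    : H ≡ before ++ (g , next-env) ∷ after

          stopped : List Symbol → Stacks 10
          stopped = walk (heapᵉ ((g , next-env) ∷ after) []) (heapᴿ before []) []

        open Stop

        goto-stop : ∀ {o r n} a {g b} → r ʳ++ o ≡ heapᵉ H [] → H [ a ] ≡ just (g , b) → ∀ {v} → v ≡ unary a →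
                    ∃[ S ] next-env {g} S ≡ b × goto ⊢ walk o r v n ↓[ length H * 26 + 7 ] stopped S n
        goto-stop a {g} {b} eq eqₐ eqv with entry-split H a eqₐ
        ... | H₁ , H₃ , refl , refl =
          record { before = H₁ ; next-env = b ; after = H₃ ; split = refl } , refl ,
          weaken↓ (+-monoˡ-≤ 7 (*-monoˡ-≤ 26 (≤-trans (m≤m+n (length H₁) _) (≤-reflexive (sym (length-++ H₁))))))
            (goto↓ H₁ _ H₃ eq size (++⁻ˡ H₁ fits) eqv)

        stop-fits : ∀ {g} (S : Stop g) → FitsE (g , next-env S)
        stop-fits record { before = H₁ ; split = refl } = All.head (++⁻ʳ H₁ fits)

        -- The `#` before `after S` is the marker left on `walkₜ` when the pointer was copied. The
        -- two stacks still make up the whole heap, as the next jump requires.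
        rewind : ∀ {P a} (S : Stop (P , a)) →
                 (unary (next-env S) ++ # ∷ unary a ʳ++ # ∷ encProgram P ʳ++ heapᴿ (before S) []) ʳ++ # ∷ heapᵉ (after S) []
                 ≡ heapᵉ H []
        rewind {P} {a} record { before = H₁ ; next-env = b ; after = H₃ ; split = refl } = begin
          (unary b ++ # ∷ unary a ʳ++ # ∷ encProgram P ʳ++ heapᴿ H₁ []) ʳ++ # ∷ heapᵉ H₃ []
            ≡⟨ ++-ʳ++ (unary b) ⟩
          (unary a ʳ++ # ∷ encProgram P ʳ++ heapᴿ H₁ []) ʳ++ # ∷ unary b ʳ++ # ∷ heapᵉ H₃ []
            ≡⟨ ʳ++-ʳ++ (unary a) ⟩
          (encProgram P ʳ++ heapᴿ H₁ []) ʳ++ # ∷ unary a ++ # ∷ unary b ʳ++ # ∷ heapᵉ H₃ []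
            ≡⟨ ʳ++-ʳ++ (encProgram P) ⟩
          heapᴿ H₁ [] ʳ++ encProgram P ++ # ∷ unary a ++ # ∷ unary b ʳ++ # ∷ heapᵉ H₃ []
            ≡⟨ cong (λ x → heapᴿ H₁ [] ʳ++ encProgram P ++ # ∷ unary a ++ # ∷ x) (unary-ʳ++ b _) ⟩
          heapᴿ H₁ [] ʳ++ heapᵉ (((P , a) , b) ∷ H₃) []
            ≡⟨ heapᴿ-ʳ++ H₁ ⟩
          heapᵉ H₁ (heapᵉ (((P , a) , b) ∷ H₃) [])
            ≡⟨ sym (heapᵉ-++ H₁) ⟩
          heapᵉ (H₁ ++ ((P , a) , b) ∷ H₃) [] ∎
          where open ≡-Reasoning

        restore : ∀ {P a} (S : Stop (P , a)) →
                  (unary (next-env S) ++ # ∷ heapᵉ (after S) []) ʳ++ # ∷ unary a ʳ++ # ∷ encProgram P ʳ++ heapᴿ (before S) []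
                  ≡ heapᴿ H []
        restore record { before = H₁ ; next-env = b ; after = H₃ ; split = refl } =
          trans (++-ʳ++ (unary b)) (trans (heapᵉ-ʳ++ H₃) (sym (heapᴿ-++ H₁)))

        rest≤U : ∀ {P a} (S : Stop (P , a)) → length (unary (next-env S) ++ # ∷ heapᵉ (after S) []) ≤ U
        rest≤U {P} {a} S = ≤-trans (m≤m+n _ _) (≤-trans (≤-reflexive (trans
          (sym (length-ʳ++ (unary (next-env S) ++ # ∷ heapᵉ (after S) [])))
          (trans (cong length (restore S)) (trans (sym (+-identityʳ _))
            (trans (sym (length-ʳ++ (heapᴿ H []))) (cong length (heapᴿ-ʳ++ H))))))) size)

        G : ℕ
        G = length H * 26 + 7

        -- The first jump is kept apart from the loop because `doVar` makes it before `chase`; in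
        -- the induction, the jump inside one round is the first jump for the remaining index.
        chase↓ : ∀ n a {g o r v} → r ʳ++ o ≡ heapᵉ H [] → H [ a ∙ n ] ≡ just g → v ≡ unary a →
                 ∃[ σ ] ∃[ S ] (goto ⊢ walk o r v (unary n) ↓[ G ] σ) × (chase ⊢ σ ↓[ n * (25 + G) + 1 ] stopped {g} S [])
        chase↓ zero a eq eqₐ eqv with H [ a ] in e
        chase↓ zero a eq refl eqv | just (g , b) =
          let S , _ , d = goto-stop a eq e eqv in _ , S , d , leave↓ refl
        chase↓ (suc n) a eq eqₐ eqv with H [ a ] in e
        ... | just ((P , a′) , b) with goto-stop {n = unary (suc n)} a eq e eqv
        ...   | S , refl , d =
          let fits , b≤U = stop-fits S
              _ , S′ , d₁ , d₂ = chase↓ n b (rewind S) eqₐ (++-identityʳ (unary b)) in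
          _ , S′ , d ,
          weaken↓ (≤-reflexive (solve 2 (λ g x → con 25 :+ g :+ (x :+ con 1) := con 25 :+ g :+ x :+ con 1) refl G (n * (25 + G))))
            (again↓ refl
              (pop↓ ⨾ seg↓ (λ ()) (encProgram P) refl (code-passes P) (code≤U P fits)
                    ⨾ seg↓ (λ ()) (unary a′) refl (unary-passes {not#} a′ refl) (unary≤U (addr≤U P fits))
                    ⨾ mvᵘ₂↓ not# (λ ()) (λ ()) (λ ()) b refl refl refl b≤U
                    ⨾ d₁) d₂)
          where open +-*-Solver

open HeapTraversal

-- The cost of simulating one step of the heap machine

module InterpreterSteps where

  module Execution (U : ℕ) (1≤U : 1 ≤ U) where

    open Bounded U 1≤U
    open Simulation U 1≤U

    private variable
      a b : Address
      P Q : Program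
      g : Closure
      T V : List Closure
      H : Heap

    -- Dominated by a lookup: one jump through N entries, then at most N rounds with a jump each.
    -- The 100 absorbs the fixed costs of all commands.
    execWeight : ℕ → ℕ
    execWeight N = 100 + (N * 26 + N * (N * 26 + 32))

    cheap : ∀ {c N} → c ≤ 100 → c ≤ execWeight N
    cheap {N = N} c≤100 = ≤-trans c≤100 (m≤m+n 100 _)

    module _ {N k : ℕ} where

      nil↓ : a ≤ U → exec ⊢ state k ⟪ ([] , a) ∷ T , V , H ⟫ ↓[ execWeight N ] state k ⟪ T , V , H ⟫
      nil↓ {a = a} a≤U = weaken↓ (cheap {N = N} (≤ᵇ⇒≤ _ 100 tt))
        (mvᵘ↓ not# (λ ()) a refl refl refl a≤U ⨾ pop↓ ⨾ else↓ refl
          (pop↓ ⨾ clear↓ (unary a ++ []) refl (≤-trans (≤-reflexive (cong length (++-identityʳ (unary a)))) (unary≤U a≤U))))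

      lam↓ : ∀ u → a ≤ U → length (encTerm u) ≤ U →
             exec ⊢ state k ⟪ (lam ∷ γ u ++ ret ∷ P , a) ∷ T , V , H ⟫ ↓[ execWeight N ]
             state k ⟪ (P , a) ∷ T , (γ u , a) ∷ V , H ⟫
      lam↓ {a = a} {P} {T} {V} {H} u a≤U u≤U = weaken↓ (cheap {N = N} (≤ᵇ⇒≤ _ 100 tt))
        (mvᵘ↓ not# (λ ()) a refl refl refl a≤U ⨾ pop↓ ⨾ then↓ refl (then↓ refl
          (pop↓ ⨾ body ⨾ pop↓ ⨾ push↓ ⨾ push↓
           ⨾ mvᵘ₂↓ not# (λ ()) (λ ()) (λ ()) a refl refl refl a≤U ⨾ push↓
           ⨾ mvBack↓ not# (λ ()) (encTerm u) refl (code-passes (γ u)) refl u≤U)))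
        where
        layout : List Symbol → List Symbol → Stacks 10
        layout r w = unary k ∷ r ∷ [] ∷ valuesᵉ V ∷ heapᴿ H [] ∷ (unary a ++ []) ∷ [] ∷ [] ∷ unary (length H) ∷ w ∷ []

        body : extract ⊢ layout (encProgram (γ u ++ ret ∷ P) ++ # ∷ tasksᵉ T) []
               ↓[ 8 ] layout (RET ∷ encProgram P ++ # ∷ tasksᵉ T) (encTerm u ʳ++ [])
        body rewrite encProgram-++ (γ u) (ret ∷ P) | ++-assoc (encTerm u) (RET ∷ encProgram P) (# ∷ tasksᵉ T)
                   | encTerm-code u {RET ∷ encProgram P ++ # ∷ tasksᵉ T} | encTerm-codeᴿ u {[]} =
          ⌊ weaken (linear 7 u≤U) (extract-run _ _ _ _ _ _ _ u _) ⌋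

      app↓ : FitsC (P , a) → FitsC g → FitsC (Q , b) → suc (length H) ≤ U →
             exec ⊢ state k ⟪ (app ∷ P , a) ∷ T , g ∷ (Q , b) ∷ V , H ⟫ ↓[ execWeight N ]
             state k ⟪ (Q , suc (length H)) ∷ (P , a) ∷ T , V , H ++ (g , b) ∷ [] ⟫
      app↓ {P} {a} {g = P′ , a′} {Q} {b} {H} {T} {V} fitsP fitsg fitsQ H≤U = weaken↓ (cheap {N = N} (≤ᵇ⇒≤ _ 100 tt))
        (resp↓ final
        (mvᵘ↓ not# (λ ()) a refl refl refl (addr≤U P fitsP) ⨾ pop↓ ⨾ then↓ refl (else↓ refl (else↓ refl
          (pop↓ ⨾ push↓ ⨾ mvᵘ↓ not# (λ ()) a refl refl refl (addr≤U P fitsP)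
          ⨾ seg↓ (λ ()) (encProgram P′) refl (code-passes P′) (code≤U P′ fitsg)
          ⨾ seg↓ (λ ()) (unary a′) refl (unary-passes {not#} a′ refl) (unary≤U (addr≤U P′ fitsg))
          ⨾ mv↓ not# (λ ()) (encProgram Q) refl (code-passes Q) refl (code≤U Q fitsQ) ⨾ pop↓
          ⨾ seg↓ (λ ()) (unary b) refl (unary-passes {not#} b refl) (unary≤U (addr≤U Q fitsQ))
          ⨾ push↓ ⨾ mvBack↓ not# (λ ()) (encProgram Q) refl (code-passes Q) refl (code≤U Q fitsQ)
          ⨾ push↓ ⨾ push↓
          ⨾ mvᵘ₂↓ not# (λ ()) (λ ()) (λ ()) (suc (length H)) (sym (++-identityʳ _)) refl refl H≤U
          ⨾ mvᵘ↓ not# (λ ()) (suc (length H)) refl refl refl H≤U)))))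
        where
        layout : List Symbol → List Symbol → Stacks 10
        layout r c = unary k ∷ tasksᵉ ((Q , suc (length H)) ∷ (P , a) ∷ T) ∷ [] ∷ valuesᵉ V ∷ r ∷ [] ∷ [] ∷ [] ∷ c ∷ [] ∷ []

        final : layout (# ∷ unary b ʳ++ # ∷ unary a′ ʳ++ # ∷ encProgram P′ ʳ++ heapᴿ H []) (unary (suc (length H)) ++ [])
                ≡ state k ⟪ (Q , suc (length H)) ∷ (P , a) ∷ T , V , H ++ ((P′ , a′) , b) ∷ [] ⟫
        final = cong₂ layout (sym (heapᴿ-++ H))
          (trans (++-identityʳ _) (cong unary (trans (+-comm 1 (length H)) (sym (length-++ H)))))

      var↓ : ∀ {n} → FitsC (P , a) → n ≤ N → n ≤ U → length H ≤ N → All FitsE H → length (heapᵉ H []) ≤ U →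
             H [ a ∙ n ] ≡ just g →
             exec ⊢ state k ⟪ (var n ∷ P , a) ∷ T , V , H ⟫ ↓[ execWeight N ] state k ⟪ (P , a) ∷ T , g ∷ V , H ⟫
      var↓ {P} {a} {H} {g = P′ , a′} {T} {V} {n} fitsP n≤N n≤U H≤N fits size eq
        with chase↓ H size fits n a {o = []} {r = heapᴿ H []} (heapᴿ-ʳ++ H) eq (++-identityʳ (unary a))
        where open Walk (unary k) (tasksᵉ ((P , a) ∷ T)) (valuesᵉ V) (unary (length H)) []
      ... | σ , S , d₁ , d₂ = weaken↓ weight (resp↓ final
        (mvᵘ↓ not# (λ ()) a refl refl refl (addr≤U P fitsP) ⨾ pop↓ ⨾ then↓ refl (else↓ refl (then↓ refl
          (pop↓ ⨾ mvᵘ₀↓ isI (λ ()) n (++-assoc (unary n) (encProgram P) _) refl refl (isI-code P) n≤U ⨾ push↓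
          ⨾ mvᵘ₂↓ not# (λ ()) (λ ()) (λ ()) a refl refl refl (addr≤U P fitsP)
          ⨾ d₁ ⨾ d₂
          ⨾ seg₂↓ (λ ()) (λ ()) (λ ()) (encProgram P′) refl (code-passes P′) (code≤U P′ fitsS)
          ⨾ seg₂↓ (λ ()) (λ ()) (λ ()) (unary a′) refl (unary-passes {not#} a′ refl) (unary≤U (addr≤U P′ fitsS))
          ⨾ mvAll↓ any (λ ()) closure refl (any-passes closure) refl closure≤U
          ⨾ mvAll↓ any (λ ()) rest refl (any-passes rest) refl (rest≤U H size fits S))))))
        where
        open Walk (unary k) (tasksᵉ ((P , a) ∷ T)) (valuesᵉ V) (unary (length H)) []
        open Stop
        fitsS : FitsC (P′ , a′)
        fitsS = proj₁ (stop-fits H size fits S)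

        closure rest : List Symbol
        closure = # ∷ unary a′ ʳ++ # ∷ encProgram P′ ʳ++ []
        rest    = unary (next-env S) ++ # ∷ heapᵉ (after S) []

        closure≤U : length closure ≤ U
        closure≤U = ≤-trans (≤-reflexive (begin
          suc (length (unary a′ ʳ++ # ∷ encProgram P′ ʳ++ []))
            ≡⟨ cong suc (length-ʳ++ (unary a′)) ⟩
          suc (length (unary a′) + suc (length (encProgram P′ ʳ++ [])))
            ≡⟨ cong₂ (λ m n → suc (m + suc n)) (length-replicate a′) (length-ʳ++ (encProgram P′)) ⟩
          suc (a′ + suc (length (encProgram P′) + 0))
            ≡⟨ solve 2 (λ a p → con 1 :+ (a :+ (con 1 :+ (p :+ con 0))) := p :+ (con 2 :+ a)) refl a′ (length (encProgram P′)) ⟩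
          length (encProgram P′) + suc (suc a′) ∎)) fitsS
          where
          open ≡-Reasoning
          open +-*-Solver

        layout : List Symbol → List Symbol → Stacks 10
        layout v r = unary k ∷ tasksᵉ ((P , a) ∷ T) ∷ [] ∷ v ∷ r ∷ [] ∷ [] ∷ [] ∷ unary (length H) ∷ [] ∷ []

        final : layout (closure ʳ++ valuesᵉ V) (rest ʳ++ # ∷ unary a′ ʳ++ # ∷ encProgram P′ ʳ++ heapᴿ (before S) [])
                ≡ state k ⟪ (P , a) ∷ T , (P′ , a′) ∷ V , H ⟫
        final = cong₂ layout (trans (ʳ++-ʳ++ (unary a′)) (ʳ++-ʳ++ (encProgram P′))) (restore H size fits S)

        weight : 24 + (G H size fits + (n * (25 + G H size fits) + 1 + 34)) ≤ execWeight N
        weight = ≤-trans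
          (+-monoʳ-≤ 24 (+-mono-≤ G≤ (+-monoˡ-≤ 34 (+-monoˡ-≤ 1 (*-mono-≤ n≤N (+-monoʳ-≤ 25 G≤))))))
          (≤-trans (m≤n+m _ 34) (≤-reflexive
            (solve 2 (λ h x → con 34 :+ (con 24 :+ (h :+ con 7 :+ (x :* (con 25 :+ (h :+ con 7)) :+ con 1 :+ con 34)))
                              := con 100 :+ (h :+ x :* (h :+ con 32))) refl (N * 26) N)))
          where
          open +-*-Solver
          G≤ : G H size fits ≤ N * 26 + 7
          G≤ = +-monoˡ-≤ 7 (*-monoˡ-≤ 26 H≤N)

open InterpreterSteps

-- Size invariants of reachable states

open import Data.Vec.Relation.Binary.Pointwise.Inductive using ([]; _∷_)
import Data.Vec.Relation.Binary.Pointwise.Inductive as Pointwise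

private variable
  s : Term
  H : Heap
  a b m n k : ℕ
  g : Closure
  e e′ : Entry
  P : Program
  σ σ′ : HeapState

entry-snoc⁻ : ∀ H a → (H ++ e ∷ []) [ a ] ≡ just e′ → H [ a ] ≡ just e′ ⊎ a ≡ suc (length H) × e ≡ e′
entry-snoc⁻ []      (suc zero)    refl = inj₂ (refl , refl)
entry-snoc⁻ (_ ∷ H) (suc zero)    eq   = inj₁ eq
entry-snoc⁻ (_ ∷ H) (suc (suc a)) eq with entry-snoc⁻ H (suc a) eq
... | inj₁ eq′        = inj₁ eq′
... | inj₂ (refl , p) = inj₂ (refl , p)

entry-All : ∀ {Q : Entry → Set} H a → All Q H → H [ a ] ≡ just e → Q e
entry-All (_ ∷ H) (suc zero)    (q ∷ qs) refl = q
entry-All (_ ∷ H) (suc (suc a)) (q ∷ qs) eq   = entry-All H (suc a) qs eq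

lookup-All : ∀ {Q : Entry → Set} H a n → All Q H → H [ a ∙ n ] ≡ just g → ∃[ b ] Q (g , b)
lookup-All H a zero qs eq with H [ a ] in eqₐ
lookup-All H a zero qs refl | just (g , b) = b , entry-All H a qs eqₐ
lookup-All H a (suc n) qs eq with H [ a ] in eqₐ
... | just (_ , b) = lookup-All H b n qs eq

Descending : Heap → Set
Descending H = ∀ a {g b} → H [ a ] ≡ just (g , b) → b < a

-- Every pointer leads to a smaller address, so a successful lookup cannot be deeper than its start.
-- This bounds indices by the fuel; a bound by |s| would make a lookup quadratic in |s|.
lookup-depth : Descending H → ∀ a n → H [ a ∙ n ] ≡ just g → n < a
lookup-depth {H} desc a zero eq with H [ a ] in eqₐ
... | just _ = ≤-<-trans z≤n (desc a eqₐ)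
lookup-depth {H} desc a (suc n) eq with H [ a ] in eqₐ
... | just (_ , b) = ≤-trans (s≤s (lookup-depth desc b n eq)) (desc a eqₐ)

heapᵉ-encHeap : ∀ H → heapᵉ H [] ≡ encHeap H
heapᵉ-encHeap []                  = refl
heapᵉ-encHeap (((P , a) , b) ∷ H) = sym (begin
  ((encProgram P ++ # ∷ unary a ++ # ∷ []) ++ unary b ++ # ∷ []) ++ encHeap H
    ≡⟨ ++-assoc (encProgram P ++ # ∷ unary a ++ # ∷ []) _ _ ⟩
  (encProgram P ++ # ∷ unary a ++ # ∷ []) ++ (unary b ++ # ∷ []) ++ encHeap H
    ≡⟨ ++-assoc (encProgram P) _ _ ⟩
  encProgram P ++ # ∷ (unary a ++ # ∷ []) ++ (unary b ++ # ∷ []) ++ encHeap H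
    ≡⟨ cong (λ x → encProgram P ++ # ∷ x) (++-assoc (unary a) _ _) ⟩
  encProgram P ++ # ∷ unary a ++ # ∷ (unary b ++ # ∷ []) ++ encHeap H
    ≡⟨ cong (λ x → encProgram P ++ # ∷ unary a ++ # ∷ x) (++-assoc (unary b) _ _) ⟩
  encProgram P ++ # ∷ unary a ++ # ∷ unary b ++ # ∷ encHeap H
    ≡⟨ cong (λ x → encProgram P ++ # ∷ unary a ++ # ∷ unary b ++ # ∷ x) (sym (heapᵉ-encHeap H)) ⟩
  heapᵉ (((P , a) , b) ∷ H) [] ∎)
  where open ≡-Reasoning

-- Programs stay subprograms of the input, and environments point backwards.
module Resources (L : ℕ) where

  SmallC : ℕ → Closure → Set
  SmallC N (P , a) = length (encProgram P) ≤ L × a ≤ N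

  SmallE : ℕ → Entry → Set
  SmallE N (g , b) = SmallC N g × b ≤ N

  record Small (σ : HeapState) : Set where
    constructor small
    field
      small-tasks  : All (SmallC (length (heap σ))) (tasks σ)
      small-values : All (SmallC (length (heap σ))) (values σ)
      small-heap   : All (SmallE (length (heap σ))) (heap σ)
      descending   : Descending (heap σ)

  SmallC-mono : m ≤ n → ∀ g → SmallC m g → SmallC n g
  SmallC-mono m≤n _ (P≤L , a≤m) = P≤L , ≤-trans a≤m m≤n

  SmallE-mono : m ≤ n → ∀ e → SmallE m e → SmallE n e
  SmallE-mono m≤n (g , _) (sg , b≤m) = SmallC-mono m≤n g sg , ≤-trans b≤m m≤n

  length-snoc : ∀ (H : Heap) → length (H ++ e ∷ []) ≡ suc (length H)
  length-snoc H = trans (length-++ H) (+-comm (length H) 1)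

  encTerm-split : ∀ u P → length (encProgram (γ u ++ ret ∷ P)) ≡ length (encTerm u) + suc (length (encProgram P))
  encTerm-split u P = trans (cong length (encProgram-++ (γ u) (ret ∷ P))) (length-++ (encTerm u))

  small-step : σ ⟶ σ′ → Small σ → Small σ′
  small-step nil (small (_ ∷ ts) vs hs desc) = small ts vs hs desc
  small-step {⟪ _ , _ , H ⟫} (var {a = a} {n = n} {P = P} eq) (small ((P≤L , a≤H) ∷ ts) vs hs desc) =
    small ((≤-trans (≤-trans (m≤n+m _ (length (unary n))) (≤-trans (≤-reflexive (sym (length-++ (unary n)))) (n≤1+n _))) P≤L , a≤H) ∷ ts)
          (proj₁ (proj₂ (lookup-All H a n hs eq)) ∷ vs) hs desc
  small-step (lam {u = u} {P = P}) (small ((P≤L , a≤H) ∷ ts) vs hs desc) =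
    small ((≤-trans (≤-trans (n≤1+n _) (m≤n+m _ (length (encTerm u)))) body≤L , a≤H) ∷ ts)
          ((≤-trans (m≤m+n _ _) body≤L , a≤H) ∷ vs) hs desc
    where
    body≤L : length (encTerm u) + suc (length (encProgram P)) ≤ L
    body≤L = ≤-trans (≤-reflexive (sym (encTerm-split u P))) (≤-trans (n≤1+n _) P≤L)
  small-step {⟪ _ , _ , H ⟫} {⟪ _ , _ , H′ ⟫} (app {g = g} {b = b}) (small ((P≤L , a≤H) ∷ ts) (sg ∷ (Q≤L , b≤H) ∷ vs) hs desc) =
    small ((Q≤L , ≤-reflexive (sym (length-snoc H))) ∷ (≤-trans (n≤1+n _) P≤L , ≤-trans a≤H H≤H′) ∷ All.map (λ {g} → SmallC-mono H≤H′ g) ts)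
          (All.map (λ {g} → SmallC-mono H≤H′ g) vs)
          (++⁺ (All.map (λ {e} → SmallE-mono H≤H′ e) hs) ((SmallC-mono H≤H′ g sg , ≤-trans b≤H H≤H′) ∷ []))
          desc′
    where
    H≤H′ : length H ≤ length H′
    H≤H′ = ≤-trans (n≤1+n _) (≤-reflexive (sym (length-snoc H)))
    desc′ : Descending H′
    desc′ a eq with entry-snoc⁻ H a eq
    ... | inj₁ eq′           = desc a eq′
    ... | inj₂ (refl , refl) = s≤s b≤H

  heap-step : σ ⟶ σ′ → length (heap σ′) ≤ suc (length (heap σ))
  heap-step nil                 = n≤1+n _
  heap-step (var _)             = n≤1+n _
  heap-step lam                 = n≤1+n _
  heap-step {⟪ _ , _ , H ⟫} app = ≤-reflexive (length-snoc H)

  heap-size : ∀ {N} H → All (SmallE N) H → length (heapᵉ H []) ≤ length H * (L + (2 * N + 3))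
  heap-size [] [] = z≤n
  heap-size {N} (((P , a) , b) ∷ H) (((P≤L , a≤N) , b≤N) ∷ hs) = begin
    length (encProgram P ++ # ∷ unary a ++ # ∷ unary b ++ # ∷ heapᵉ H [])
      ≡⟨ lengths ⟩
    length (encProgram P) + suc (a + suc (b + suc (length (heapᵉ H []))))
      ≤⟨ +-mono-≤ P≤L (s≤s (+-mono-≤ a≤N (s≤s (+-mono-≤ b≤N (s≤s (heap-size H hs)))))) ⟩
    L + suc (N + suc (N + suc (length H * (L + (2 * N + 3)))))
      ≡⟨ solve 3 (λ l n x → l :+ (con 1 :+ (n :+ (con 1 :+ (n :+ (con 1 :+ x))))) := l :+ (con 2 :* n :+ con 3) :+ x)
           refl L N (length H * (L + (2 * N + 3))) ⟩
    L + (2 * N + 3) + length H * (L + (2 * N + 3)) ∎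
    where
    open ≤-Reasoning
    open +-*-Solver
    lengths : length (encProgram P ++ # ∷ unary a ++ # ∷ unary b ++ # ∷ heapᵉ H [])
              ≡ length (encProgram P) + suc (a + suc (b + suc (length (heapᵉ H []))))
    lengths = trans (length-++ (encProgram P)) (cong (λ x → length (encProgram P) + suc x)
      (trans (length-++ (unary a)) (cong₂ (λ x y → x + suc y) (length-replicate a)
        (trans (length-++ (unary b)) (cong (_+ suc (length (heapᵉ H []))) (length-replicate b))))))

-- The whole program, run on a given amount of fuel

-- `setup` turns the input into a single task: a marker below the code ends it, and a bare marker
-- above it is the address 0.
setup loop : Prog 10
setup = mv any tasksₜ tempₜ ⨟ push tasksₜ (const #) ⨟ mv any tempₜ tasksₜ ⨟ push tasksₜ (const #)
loop = while (λ cs → any (lookup cs tasksₜ) ∧ any (lookup cs fuelₜ)) (pop fuelₜ ⨟ exec)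

-- Opaque: comparing configurations must not unfold the table of the machine.
opaque
  main : Prog 10
  main = setup ⨟ loop ⨟ mv any heapₜ walkₜ

-- The tasks decide, not the fuel: the last unit of fuel may have paid for the last step.
accept : Tops 10 → Bool
accept cs = not (any (lookup cs tasksₜ))

open Compiled main accept

-- One run of the machine with fuel N on a program of length L.
module Fuelled (L N : ℕ) where

  open Resources L

  -- `2 + L + N` covers a closure with its markers, and the product covers a heap of N entries, each
  -- with a program, two addresses and three markers.
  U : ℕ
  U = 2 + L + N + N * (L + (2 * N + 3))

  1≤U : 1 ≤ U
  1≤U = s≤s z≤n

  open Bounded U 1≤U
  open Simulation U 1≤U using (FitsC; FitsE)
  open Execution U 1≤U

  L≤U : L ≤ U
  L≤U = ≤-trans (m≤n+m L 2) (≤-trans (m≤m+n (2 + L) N) (m≤m+n _ _))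

  N≤U : N ≤ U
  N≤U = ≤-trans (m≤n+m N (2 + L)) (m≤m+n _ _)

  fitsC : m ≤ N → ∀ g → SmallC m g → FitsC g
  fitsC m≤N (P , a) (P≤L , a≤m) = begin
    length (encProgram P) + suc (suc a) ≤⟨ +-mono-≤ P≤L (s≤s (s≤s (≤-trans a≤m m≤N))) ⟩
    L + suc (suc N)                     ≡⟨ solve 2 (λ l n → l :+ (con 2 :+ n) := con 2 :+ l :+ n) refl L N ⟩
    2 + L + N                           ≤⟨ m≤m+n _ _ ⟩
    U ∎
    where
    open ≤-Reasoning
    open +-*-Solver

  fitsE : m ≤ N → ∀ e → SmallE m e → FitsE e
  fitsE m≤N (g , _) (sg , b≤m) = fitsC m≤N g sg , ≤-trans b≤m (≤-trans m≤N N≤U)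

  heap≤U : Small σ → length (heap σ) ≤ N → length (heapᵉ (heap σ) []) ≤ U
  heap≤U {⟪ _ , _ , H ⟫} (small _ _ hs _) H≤N = begin
    length (heapᵉ H [])             ≤⟨ heap-size H (All.map (λ {e} → SmallE-mono H≤N e) hs) ⟩
    length H * (L + (2 * N + 3))    ≤⟨ *-monoˡ-≤ (L + (2 * N + 3)) H≤N ⟩
    N * (L + (2 * N + 3))           ≤⟨ m≤n+m _ _ ⟩
    U ∎
    where open ≤-Reasoning

  -- The bound on the heap is strict because `app` creates one more address, which must still fit.
  exec↓ : σ ⟶ σ′ → Small σ → length (heap σ) < N → exec ⊢ state k σ ↓[ execWeight N ] state k σ′
  exec↓ (nil {T = T} {V = V} {H = H}) (small ((_ , a≤H) ∷ _) _ _ _) H<N =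
    nil↓ {N = N} {T = T} {V = V} {H = H} (≤-trans a≤H (≤-trans (<⇒≤ H<N) N≤U))
  exec↓ (lam {u = u} {P = P} {T = T} {V = V} {H = H}) (small ((P≤L , a≤H) ∷ _) _ _ _) H<N =
    lam↓ {N = N} {P = P} {T = T} {V = V} {H = H} u (≤-trans a≤H (≤-trans (<⇒≤ H<N) N≤U))
      (≤-trans (m≤m+n _ (suc (length (encProgram P)))) (≤-trans (≤-reflexive (sym (encTerm-split u P)))
        (≤-trans (n≤1+n _) (≤-trans P≤L L≤U))))
  exec↓ (app {P = P} {a = a} {T = T} {g = g} {Q = Q} {b = b} {V = V} {H = H}) (small ((P≤L , a≤H) ∷ _) (sg ∷ sf ∷ _) _ _) H<N =
    app↓ {N = N} {P = P} {a = a} {g = g} {Q = Q} {b = b} {H = H} {T = T} {V = V}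
      (fitsC (<⇒≤ H<N) (P , a) (≤-trans (n≤1+n _) P≤L , a≤H)) (fitsC (<⇒≤ H<N) g sg) (fitsC (<⇒≤ H<N) (Q , b) sf)
      (≤-trans H<N N≤U)
  exec↓ d@(var {H = H} {a = a} {n = n} {g = g} {P = P} {T = T} {V = V} eq) st@(small ((_ , a≤H) ∷ _) _ hs desc) H<N
    with small-step d st
  ... | small (sP ∷ _) _ _ _ =
    var↓ {P = P} {a = a} {H = H} {g = g} {T = T} {V = V} (fitsC (<⇒≤ H<N) (P , a) sP) n≤N (≤-trans n≤N N≤U) (<⇒≤ H<N)
      (All.map (λ {e} → fitsE (<⇒≤ H<N) e) hs) (heap≤U st (<⇒≤ H<N)) eq
    where
    n≤N : n ≤ N
    n≤N = ≤-trans (<⇒≤ (lookup-depth desc a n eq)) (≤-trans a≤H (<⇒≤ H<N))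

  record Final (s : Term) (k : ℕ) (σ : HeapState) : Set where
    field
      {steps}   : ℕ
      is-reached : Reached s steps σ
      is-small  : Small σ
      heap≤steps : length (heap σ) ≤ steps
      fuel-used : steps + k ≡ N
      stops     : tasks σ ≡ [] ⊎ k ≡ 0

  loopWeight : ℕ
  loopWeight = 2 + execWeight N

  nonempty-tasks : ∀ a {r} → any (head (unary a ++ # ∷ r)) ≡ true
  nonempty-tasks zero    = refl
  nonempty-tasks (suc a) = refl

  loop↓ : ∀ k {s m σ} → Reached s m σ → Small σ → length (heap σ) ≤ m → m + k ≡ N →
          ∃[ k′ ] ∃[ σ′ ] Final s k′ σ′ × loop ⊢ state k σ ↓[ k * loopWeight + 1 ] state k′ σ′
  loop↓ k {σ = ⟪ [] , _ , _ ⟫} r sm H≤m eq =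
    k , _ , record { is-reached = r ; is-small = sm ; heap≤steps = H≤m ; fuel-used = eq ; stops = inj₁ refl } ,
    weaken↓ (m≤n+m 1 _) (leave↓ refl)
  loop↓ zero {σ = ⟪ _ ∷ _ , _ , _ ⟫} r sm H≤m eq =
    zero , _ , record { is-reached = r ; is-small = sm ; heap≤steps = H≤m ; fuel-used = eq ; stops = inj₂ refl } ,
    leave↓ (∧-zeroʳ _)
  loop↓ (suc k) {m = m} {⟪ (_ , a) ∷ _ , _ , _ ⟫} r sm H≤m eq =
    let σ₁ , d , r₁ , _ = reached-step r
        k′ , σ′ , fin , e = loop↓ k r₁ (small-step d sm) (≤-trans (heap-step d) (s≤s H≤m)) (trans (sym (+-suc m k)) eq)
    in k′ , σ′ , fin ,
       weaken↓ (≤-reflexive (sym (+-assoc loopWeight (k * loopWeight) 1)))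
         (again↓ (cong (_∧ true) (nonempty-tasks a))
           -- After m steps there are at most m entries, and the unit of fuel just spent shows m <
           -- N.
           (pop↓ ⨾ exec↓ d sm (≤-<-trans H≤m (≤-trans (s≤s (m≤m+n m k)) (≤-reflexive (trans (sym (+-suc m k)) eq))))) e)

  start : Term → Stacks 10
  start s = unary N ∷ encTerm s ∷ replicateᵛ 8 []

  output : ℕ → HeapState → Stacks 10
  output k ⟪ T , V , H ⟫ =
    unary k ∷ tasksᵉ T ∷ encHeap H ∷ valuesᵉ V ∷ [] ∷ [] ∷ [] ∷ [] ∷ unary (length H) ∷ [] ∷ []

  totalWeight : ℕ
  totalWeight = 20 + N * loopWeight

  setup↓ : ∀ s → length (encTerm s) ≤ U → setup ⊢ start s ↓[ 14 ] state N (initial s)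
  setup↓ s s≤U =
    mvAll↓ any (λ ()) (encTerm s) refl (any-passes (encTerm s)) refl s≤U ⨾ push↓
    ⨾ mvBack↓ any (λ ()) (encTerm s) refl (any-passes (encTerm s)) refl s≤U ⨾ push↓

  deliver↓ : ∀ {k σ} → Small σ → length (heap σ) ≤ N → mv any heapₜ walkₜ ⊢ state k σ ↓[ 5 ] output k σ
  deliver↓ {k} {σ@(⟪ T , V , H ⟫)} sm H≤N =
    resp↓ (cong (λ h → unary k ∷ tasksᵉ T ∷ h ∷ valuesᵉ V ∷ [] ∷ [] ∷ [] ∷ [] ∷ unary (length H) ∷ [] ∷ [])
                (trans (heapᴿ-ʳ++ H) (heapᵉ-encHeap H)))
      (mvAll↓ any (λ ()) (heapᴿ H []) refl (any-passes (heapᴿ H [])) refl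
        (≤-trans (≤-reflexive (trans (sym (+-identityʳ _))
          (trans (sym (length-ʳ++ (heapᴿ H []))) (cong length (heapᴿ-ʳ++ H))))) (heap≤U sm H≤N)))

  opaque
    unfolding main

    main↓ : ∀ {s} → Closed s → length (encTerm s) ≤ L →
            ∃[ k ] ∃[ σ ] Final s k σ × main ⊢ start s ↓[ totalWeight ] output k σ
    main↓ {s} c s≤L with loop↓ N (reached-initial c) (small ((s≤L , z≤n) ∷ []) [] [] (λ _ ())) z≤n refl
    ... | k , σ , fin , d = k , σ , fin ,
      weaken↓ (≤-reflexive (solve 1 (λ x → con 14 :+ (x :+ con 1 :+ con 5) := con 20 :+ x) refl (N * loopWeight)))
        (setup↓ s (≤-trans s≤L L≤U) ⨾ d ⨾ deliver↓ (Final.is-small fin)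
          (≤-trans (Final.heap≤steps fin) (≤-trans (m≤m+n _ k) (≤-reflexive (Final.fuel-used fin)))))
      where open +-*-Solver

-- Polynomial bounds and the theorem

writeTape-holds : ∀ w → Holds machine w (writeTape machine w)
writeTape-holds []      = [] , 1 , refl
writeTape-holds (x ∷ w) = [] , 0 , sym (++-identityʳ _)

input-≈ : ∀ k s → proj₂ (input {6} machine k s) ≈ Fuelled.start 0 k s
input-≈ k s = writeTape-holds (unary k) ∷ writeTape-holds (encTerm s)
  ∷ blank ∷ blank ∷ blank ∷ blank ∷ blank ∷ blank ∷ blank ∷ blank ∷ []
  where
  blank : Holds machine [] (blankTape machine)
  blank = writeTape-holds []

failure : State
failure = inj₂ (just false)

-- The factor 2 is due to abstractions, which add 1 to the size but both `LAM` and `RET` to the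
-- code.
length-encTerm≤ : ∀ s → length (encTerm s) ≤ ∣ s ∣ᵗ * 2
length-encTerm≤ (` n) = begin
  length (encTerm (` n))       ≡⟨ cong suc (cong length (++-identityʳ (unary n))) ⟩
  suc (length (unary n))       ≡⟨ cong suc (length-replicate n) ⟩
  suc n                        ≤⟨ m≤m*n (suc n) 2 ⟩
  suc n * 2 ∎
  where open ≤-Reasoning
length-encTerm≤ (s · t) = begin
  length (encTerm (s · t))                           ≡⟨ length-encTerm-· s t ⟩
  length (encTerm s) + (length (encTerm t) + 1)      ≤⟨ +-mono-≤ (length-encTerm≤ s) (+-monoˡ-≤ 1 (length-encTerm≤ t)) ⟩
  ∣ s ∣ᵗ * 2 + (∣ t ∣ᵗ * 2 + 1)                      ≤⟨ n≤1+n _ ⟩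
  suc (∣ s ∣ᵗ * 2 + (∣ t ∣ᵗ * 2 + 1))
    ≡⟨ solve 2 (λ x y → con 1 :+ (x :* con 2 :+ (y :* con 2 :+ con 1)) := (con 1 :+ x :+ y) :* con 2) refl ∣ s ∣ᵗ ∣ t ∣ᵗ ⟩
  (1 + ∣ s ∣ᵗ + ∣ t ∣ᵗ) * 2 ∎
  where
  open ≤-Reasoning
  open +-*-Solver
length-encTerm≤ (ƛ s) = begin
  length (encTerm (ƛ s))        ≡⟨ length-encTerm-ƛ s ⟩
  suc (length (encTerm s) + 1)  ≤⟨ s≤s (+-monoˡ-≤ 1 (length-encTerm≤ s)) ⟩
  suc (∣ s ∣ᵗ * 2 + 1)          ≡⟨ cong suc (+-comm _ 1) ⟩
  (1 + ∣ s ∣ᵗ) * 2 ∎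
  where open ≤-Reasoning

1≤∣_∣ᵗ : ∀ s → 1 ≤ ∣ s ∣ᵗ
1≤∣ ` n ∣ᵗ   = s≤s z≤n
1≤∣ s · t ∣ᵗ = s≤s z≤n
1≤∣ ƛ s ∣ᵗ   = s≤s z≤n

module Polynomials where

  open +-*-Solver

  -- `unitᴾ` is `U` with |s| factored out, and the first factor of `timeᴾ` is `1 + totalWeight`. In
  -- `spaceᴾ`, 10 is the number of tapes and `12 + x` accounts for the input.
  unitᴾ timeᴾ spaceᴾ : ∀ {n} → Polynomial n → Polynomial n
  unitᴾ x  = con 4 :+ x :+ x :* (con 2 :+ (con 2 :* x :+ con 3))
  timeᴾ x  = (con 21 :+ x :* (con 102 :+ (x :* con 26 :+ x :* (x :* con 26 :+ con 32)))) :* unitᴾ x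
  spaceᴾ x = timeᴾ x :* con 10 :+ (con 12 :+ x)

  timeᴾ₂ : Polynomial 2
  timeᴾ₂ = var 0F :* timeᴾ (var 1F)

  spaceᴾ₁ : Polynomial 1
  spaceᴾ₁ = spaceᴾ (var 0F)

  unit timeBound spaceBound : ℕ → ℕ
  unit       = eval₁ (unitᴾ (var 0F))
  timeBound  = eval₁ (timeᴾ (var 0F))
  spaceBound = eval₁ spaceᴾ₁

open Polynomials using (timeᴾ₂; spaceᴾ₁; unit; timeBound; spaceBound)

module _ (k : ℕ) (s : Term) (s-closed : Closed s) where

  private
    L = length (encTerm s)
    y = ∣ s ∣ᵗ

    L≤ : L ≤ y * 2
    L≤ = length-encTerm≤ s

    scaled : ∀ m → m ≤ y * m
    scaled m = ≤-trans (≤-reflexive (sym (*-identityˡ m))) (*-monoˡ-≤ m 1≤∣ s ∣ᵗ)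

  open Fuelled L k

  -- `U` is affine in `L`; since |s| is at least 1, the terms without `L` can be scaled by |s| too,
  -- and a single factor |s| comes out.
  U≤ : U ≤ y * unit k
  U≤ = begin
    2 + L + k + k * (L + (2 * k + 3))
      ≤⟨ +-mono-≤ (+-mono-≤ (+-mono-≤ (scaled 2) L≤) (scaled k)) (*-monoʳ-≤ k (+-mono-≤ L≤ (scaled (2 * k + 3)))) ⟩
    y * 2 + y * 2 + y * k + k * (y * 2 + y * (2 * k + 3))
      ≡⟨ solve 2 (λ y k → y :* con 2 :+ y :* con 2 :+ y :* k :+ k :* (y :* con 2 :+ y :* (con 2 :* k :+ con 3))
                          := y :* (con 4 :+ k :+ k :* (con 2 :+ (con 2 :* k :+ con 3)))) refl y k ⟩
    y * unit k ∎
    where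
    open ≤-Reasoning
    open +-*-Solver

  time≤ : suc (totalWeight * U) ≤ y * timeBound k
  time≤ = begin
    -- The successor is the transition that announces the verdict.
    suc (totalWeight * U)                   ≤⟨ +-monoˡ-≤ (totalWeight * U) 1≤U ⟩
    (1 + totalWeight) * U                   ≤⟨ *-monoʳ-≤ (1 + totalWeight) U≤ ⟩
    (1 + totalWeight) * (y * unit k)        ≡⟨ solve 3 (λ w y u → w :* (y :* u) := y :* (w :* u)) refl (1 + totalWeight) y (unit k) ⟩
    y * timeBound k ∎
    where
    open ≤-Reasoning
    open +-*-Solver

  -- With tasks left the loop stopped for lack of fuel, so exactly k steps were made, and an
  -- unfinished run has made fewer than 4j + 2.
  too-short : ∀ {k′ h T V H t j} → Final s k′ ⟪ h ∷ T , V , H ⟫ → NormalForm s t j → ¬ k ≥ 4 * j + 2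
  too-short fin nf with Final.stops fin
  ... | inj₂ refl = <⇒≱ (≤-<-trans (≤-reflexive (trans (sym (Final.fuel-used fin)) (+-identityʳ _)))
                                   (reached-unfinished nf (Final.is-reached fin)))

  outcome : ∃[ i ] ∃[ k′ ] ∃[ σ ] ∃[ Ts ] i ≤ y * timeBound k × Final s k′ σ × Ts ≈ output k′ σ ×
            run machine i (input {6} machine k s) ≡ (inj₂ (just (accept (tops (output k′ σ)))) , Ts)
  outcome =
    let k′ , σ , fin , ⌊ d ⌋ = main↓ s-closed ≤-refl
        i , Ts , i≤ , h , eq = verdict d (input-≈ k s)
    in i , k′ , σ , Ts , ≤-trans i≤ time≤ , fin , h , eq
    where open Bounded U 1≤U

  halts : HaltsWithin machine (y * timeBound k) (input {6} machine k s)
  halts = let i , _ , _ , _ , i≤ , _ , _ , eq = outcome in i , i≤ , cong (final ∘ proj₁) eq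

  input-size : size machine (input {6} machine k s) ≤ y * (12 + k)
  input-size = begin
    tapeSize machine (writeTape machine (unary k)) + (tapeSize machine (writeTape machine (encTerm s)) + 8)
      ≤⟨ +-mono-≤ (tape≤ (unary k)) (+-monoˡ-≤ 8 (tape≤ (encTerm s))) ⟩
    suc (length (unary k)) + (suc L + 8)   ≡⟨ cong (λ l → suc l + (suc L + 8)) (length-replicate k) ⟩
    suc k + (suc L + 8)                    ≡⟨ solve 2 (λ k l → con 1 :+ k :+ (con 1 :+ l :+ con 8) := l :+ (con 10 :+ k)) refl k L ⟩
    L + (10 + k)                           ≤⟨ +-mono-≤ L≤ (scaled (10 + k)) ⟩
    y * 2 + y * (10 + k)                   ≡⟨ sym (*-distribˡ-+ y 2 (10 + k)) ⟩
    y * (12 + k) ∎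
    where
    open ≤-Reasoning
    open +-*-Solver
    tape≤ : ∀ w → tapeSize machine (writeTape machine w) ≤ suc (length w)
    tape≤ []      = ≤-refl
    tape≤ (x ∷ w) = s≤s (≤-trans (≤-reflexive (length-map _ w)) (n≤1+n _))

  space : SpaceWithin machine (y * spaceBound k) (input {6} machine k s)
  space j = begin
    size machine (run machine j c)                ≤⟨ (let i , i≤ , h = halts in halts⇒space {i = i} {c = c} i≤ h j) ⟩
    y * timeBound k * 10 + size machine c         ≤⟨ +-monoʳ-≤ (y * timeBound k * 10) input-size ⟩
    y * timeBound k * 10 + y * (12 + k)           ≡⟨ solve 3 (λ y t k → y :* t :* con 10 :+ y :* k := y :* (t :* con 10 :+ k)) refl y (timeBound k) (12 + k) ⟩
    y * spaceBound k ∎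
    where
    open ≤-Reasoning
    open +-*-Solver
    c = input {6} machine k s

  succeeds : ∀ t j → NormalForm s t j → k ≥ 4 * j + 2 →
             ∃[ H ] ∃[ g ] g ≫[ H ] t
               × HaltsWith machine (λ c → proj₁ c ≢ failure × Outputs {6} machine H g c) (input {6} machine k s)
  succeeds t j nf@(d , t-abs) k≥ =
    let i , _ , σ , _ , _ , fin , h , eq = outcome in finished i σ fin h eq
    where
    Success : Set
    Success = ∃[ H ] ∃[ g ] g ≫[ H ] t
      × HaltsWith machine (λ c → proj₁ c ≢ failure × Outputs {6} machine H g c) (input {6} machine k s)

    single : ∀ i {k′ V H Ts} g → V ≡ g ∷ [] → g ≫[ H ] t → Ts ≈ output k′ ⟪ [] , V , H ⟫ →
             run machine i (input {6} machine k s) ≡ (inj₂ (just true) , Ts) → Success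
    single i {H = H} g refl g≫t h eq =
      H , g , g≫t , haltsWith (λ c → proj₁ c ≢ failure × Outputs {6} machine H g c) i eq refl ((λ ()) , Pointwise.lookup h 2F , Pointwise.lookup h 3F)

    finished : ∀ i {k′ Ts} σ → Final s k′ σ → Ts ≈ output k′ σ →
               run machine i (input {6} machine k s) ≡ (inj₂ (just (accept (tops (output k′ σ)))) , Ts) → Success
    finished i ⟪ [] , V , H ⟫ fin h eq =
      let g , V≡ , g≫t = reached-normal (Final.is-reached fin) nf in single i g V≡ g≫t h eq
    finished i ⟪ _ ∷ _ , _ , _ ⟫ fin h eq = contradiction k≥ (too-short fin nf)

  -- By contraposition: a run that empties the tasks exhibits a normal form reached in j steps with
  -- 4j + 2 at most k.
  fails : ¬ (∃[ t ] ∃[ j ] NormalForm s t j × k ≥ 4 * j + 2) →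
          HaltsWith machine (λ c → proj₁ c ≡ failure) (input {6} machine k s)
  fails none = let i , _ , σ , _ , _ , fin , _ , eq = outcome in unfinished i σ fin eq
    where
    unfinished : ∀ i {k′ Ts} σ → Final s k′ σ →
                 run machine i (input {6} machine k s) ≡ (inj₂ (just (accept (tops (output k′ σ)))) , Ts) →
                 HaltsWith machine (λ c → proj₁ c ≡ failure) (input {6} machine k s)
    unfinished i {k′ = k′} ⟪ [] , _ , _ ⟫ fin _ =
      let _ , t , j , _ , _ , nf , m≡ = reached-final (Final.is-reached fin) in
      contradiction
        (t , j , nf , ≤-trans (≤-reflexive (sym m≡)) (≤-trans (m≤m+n _ k′) (≤-reflexive (Final.fuel-used fin))))
        none
    unfinished i ⟪ (P , a) ∷ T , _ , _ ⟫ _ eq =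
      let v≡ = cong (λ v → inj₂ (just (not v))) (nonempty-tasks a) in haltsWith (λ c → proj₁ c ≡ failure) i eq (cong final v≡) v≡

theorem19 : ∃[ w ] Σ[ M ∈ TM Symbol (4 + w) ] Σ[ failure ∈ TM.State M ]
    TM.final M failure ≡ true
    × (Σ[ p ∈ Polynomial 2 ] HaltsInTimeO M (λ m k → eval₂ p m k))
    × (Σ[ q ∈ Polynomial 1 ] RunsInSpaceO M (λ m k → m * eval₁ q k))
    × (∀ k s → Closed s →
    (∀ t j → NormalForm s t j → k ≥ 4 * j + 2 →
    ∃[ H ] ∃[ g ] g ≫[ H ] t
    × HaltsWith M (λ c → proj₁ c ≢ failure × Outputs M H g c) (input M k s))
    × (¬ (∃[ t ] ∃[ j ] NormalForm s t j × k ≥ 4 * j + 2) →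
    HaltsWith M (λ c → proj₁ c ≡ failure) (input M k s)))
theorem19 = 6 , machine , failure , refl
  , (timeᴾ₂ , 1 , λ k s c → let i , i≤ , h = halts k s c in i , ≤-trans i≤ (≤-reflexive (sym (*-identityˡ _))) , h)
  , (spaceᴾ₁ , 1 , λ k s c i → ≤-trans (space k s c i) (≤-reflexive (sym (*-identityˡ _))))
  , λ k s c → succeeds k s c , fails k s c
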